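{- Let $\phi$ be the real root of $x^3=x^2+x+1$. For any positive integer $k$ and any integer $n>0.2\phi^{3k/2}$, there exists a positive tribonacci sequence of length $k$ terminating at $n$.
   Context: A tribonacci sequence of length $k$ is a sequence of integers $\langle a_i\rangle_{i=1}^k$ such that $a_i=a_{i-1}+a_{i-2}+a_{i-3}$ for all $4\le i\le k$. It terminates at $a_k$, and it is positive if $a_1,a_2,a_3>0$ (for length less than 3, all terms are required to be positive). -}

module Defs where

open import Data.Fin using (Fin; toℕ)
open import Data.Integer as ℤ using (ℤ; 0ℤ)
open import Data.Nat as ℕ using (ℕ; zero; suc; _⊔_)
import Data.Nat.Properties as ℕ
open import Data.Product using (∃-syntax; _×_; _,_)
open import Data.Rational as ℚ using (ℚ; 0ℚ; 1ℚ; ½; ∣_∣)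
import Data.Rational.Properties as ℚ
open import Data.Rational.Solver using (module +-*-Solver)
open import Data.Vec.Functional using (Vector)
open import Relation.Binary.PropositionalEquality

------------------------------------------------------------------------
-- Real numbers as Cauchy sequences of rationals, each with a modulus of
-- convergence, compared by the setoid equality _≃_.

IsCauchy : (ℕ → ℚ) → Set
IsCauchy s = ∀ (ε : ℚ) → 0ℚ ℚ.< ε →
  ∃[ N ] (∀ m n → N ℕ.≤ m → N ℕ.≤ n → ∣ s m ℚ.- s n ∣ ℚ.≤ ε)

record ℝ : Set where
  constructor mkℝ
  field
    seq    : ℕ → ℚ
    cauchy : IsCauchy seq

open ℝ public

infix  4 _≃_ _<_
infixl 6 _+_
infixl 7 _*_
infixr 8 _^_

_≃_ : ℝ → ℝ → Set
x ≃ y = ∀ (ε : ℚ) → 0ℚ ℚ.< ε →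
  ∃[ N ] (∀ n → N ℕ.≤ n → ∣ seq x n ℚ.- seq y n ∣ ℚ.≤ ε)

_<_ : ℝ → ℝ → Set
x < y = ∃[ ε ] (0ℚ ℚ.< ε ×
  ∃[ N ] (∀ n → N ℕ.≤ n → seq x n ℚ.+ ε ℚ.≤ seq y n))

fromℚ : ℚ → ℝ
fromℚ q = mkℝ (λ _ → q) λ ε 0<ε → 0 , λ _ _ _ _ →
  subst (ℚ._≤ ε) (cong ∣_∣ (sym (ℚ.+-inverseʳ q))) (ℚ.<⇒≤ 0<ε)

fromℤ : ℤ → ℝ
fromℤ z = fromℚ (z ℚ./ 1)

0ℝ 1ℝ : ℝ
0ℝ = fromℚ 0ℚ
1ℝ = fromℚ 1ℚ

private
  *-pos : ∀ {p q} → 0ℚ ℚ.< p → 0ℚ ℚ.< q → 0ℚ ℚ.< p ℚ.* q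
  *-pos {p} {q} 0<p 0<q =
    subst (ℚ._< p ℚ.* q) (ℚ.*-zeroʳ p)
      (ℚ.*-monoʳ-<-pos p {{ℚ.positive 0<p}} 0<q)

  0≤∣_∣ : ∀ p → 0ℚ ℚ.≤ ∣ p ∣
  0≤∣ p ∣ = ℚ.nonNegative⁻¹ ∣ p ∣ {{ℚ.∣-∣-nonNeg p}}

  ∣*∣-mono-≤ : ∀ p r q s →
    ∣ p ∣ ℚ.≤ q → ∣ r ∣ ℚ.≤ s → ∣ p ℚ.* r ∣ ℚ.≤ q ℚ.* s
  ∣*∣-mono-≤ p r q s p≤q r≤s = begin
    ∣ p ℚ.* r ∣       ≡⟨ ℚ.∣p*q∣≡∣p∣*∣q∣ p r ⟩
    ∣ p ∣ ℚ.* ∣ r ∣   ≤⟨ ℚ.*-monoʳ-≤-nonNeg ∣ r ∣ {{ℚ.∣-∣-nonNeg r}} p≤q ⟩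
    q ℚ.* ∣ r ∣       ≤⟨ ℚ.*-monoˡ-≤-nonNeg q {{ℚ.nonNegative 0≤q}} r≤s ⟩
    q ℚ.* s           ∎
    where
    open ℚ.≤-Reasoning
    0≤q : 0ℚ ℚ.≤ q
    0≤q = ℚ.≤-trans 0≤∣ p ∣ p≤q

  divide : ∀ C ε → 0ℚ ℚ.< C → 0ℚ ℚ.< ε → ∃[ δ ] (0ℚ ℚ.< δ × C ℚ.* δ ≡ ε)
  divide C ε 0<C 0<ε = 1/C ℚ.* ε , *-pos 0<1/C 0<ε , (begin
    C ℚ.* (1/C ℚ.* ε)   ≡⟨ ℚ.*-assoc C 1/C ε ⟨
    C ℚ.* 1/C ℚ.* ε     ≡⟨ cong (ℚ._* ε) (ℚ.*-inverseʳ C) ⟩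
    1ℚ ℚ.* ε            ≡⟨ ℚ.*-identityˡ ε ⟩
    ε                   ∎)
    where
    open ≡-Reasoning
    instance
      C-pos : ℚ.Positive C
      C-pos = ℚ.positive 0<C
      C-nonZero : ℚ.NonZero C
      C-nonZero = ℚ.pos⇒nonZero C
    1/C : ℚ
    1/C = ℚ.1/ C
    0<1/C : 0ℚ ℚ.< 1/C
    0<1/C = ℚ.positive⁻¹ 1/C {{ℚ.1/pos⇒pos C}}

  0<½ : 0ℚ ℚ.< ½
  0<½ = ℚ.positive⁻¹ ½

  0<1 : 0ℚ ℚ.< 1ℚ
  0<1 = ℚ.positive⁻¹ 1ℚ

  bounded : ∀ s → IsCauchy s →
    ∃[ N ] ∃[ B ] (0ℚ ℚ.< B × (∀ n → N ℕ.≤ n → ∣ s n ∣ ℚ.≤ B))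
  bounded s c with c 1ℚ 0<1
  ... | N , close = N , 1ℚ ℚ.+ ∣ s N ∣ , 0<B , λ n N≤n → begin
      ∣ s n ∣                       ≡⟨ cong ∣_∣ (rearrange (s n) (s N)) ⟩
      ∣ (s n ℚ.- s N) ℚ.+ s N ∣     ≤⟨ ℚ.∣p+q∣≤∣p∣+∣q∣ (s n ℚ.- s N) (s N) ⟩
      ∣ s n ℚ.- s N ∣ ℚ.+ ∣ s N ∣   ≤⟨ ℚ.+-monoˡ-≤ ∣ s N ∣ (close n N N≤n ℕ.≤-refl) ⟩
      1ℚ ℚ.+ ∣ s N ∣                ∎
    where
    open ℚ.≤-Reasoning
    0<B : 0ℚ ℚ.< 1ℚ ℚ.+ ∣ s N ∣
    0<B = ℚ.+-mono-<-≤ 0<1 0≤∣ s N ∣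
    rearrange : ∀ p q → p ≡ (p ℚ.- q) ℚ.+ q
    rearrange = solve 2 (λ p q → p := (p :- q) :+ q) refl
      where open +-*-Solver

  +-cauchy : ∀ s t → IsCauchy s → IsCauchy t → IsCauchy (λ n → s n ℚ.+ t n)
  +-cauchy s t cs ct ε 0<ε
    with cs (ε ℚ.* ½) (*-pos 0<ε 0<½) | ct (ε ℚ.* ½) (*-pos 0<ε 0<½)
  ... | M , closeₛ | N , closeₜ = M ⊔ N , λ m n p q → begin
    ∣ (s m ℚ.+ t m) ℚ.- (s n ℚ.+ t n) ∣
      ≡⟨ cong ∣_∣ (rearrange (s m) (t m) (s n) (t n)) ⟩
    ∣ (s m ℚ.- s n) ℚ.+ (t m ℚ.- t n) ∣
      ≤⟨ ℚ.∣p+q∣≤∣p∣+∣q∣ (s m ℚ.- s n) (t m ℚ.- t n) ⟩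
    ∣ s m ℚ.- s n ∣ ℚ.+ ∣ t m ℚ.- t n ∣
      ≤⟨ ℚ.+-mono-≤
           (closeₛ m n (ℕ.m⊔n≤o⇒m≤o M N p) (ℕ.m⊔n≤o⇒m≤o M N q))
           (closeₜ m n (ℕ.m⊔n≤o⇒n≤o M N p) (ℕ.m⊔n≤o⇒n≤o M N q)) ⟩
    ε ℚ.* ½ ℚ.+ ε ℚ.* ½
      ≡⟨ ℚ.*-distribˡ-+ ε ½ ½ ⟨
    ε ℚ.* 1ℚ
      ≡⟨ ℚ.*-identityʳ ε ⟩
    ε ∎
    where
    open ℚ.≤-Reasoning
    rearrange : ∀ p q p′ q′ →
      (p ℚ.+ q) ℚ.- (p′ ℚ.+ q′) ≡ (p ℚ.- p′) ℚ.+ (q ℚ.- q′)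
    rearrange = solve 4 (λ p q p′ q′ →
      (p :+ q) :- (p′ :+ q′) := (p :- p′) :+ (q :- q′)) refl
      where open +-*-Solver

  product-close : ∀ p q p′ q′ A B δ →
    ∣ p ∣ ℚ.≤ A → ∣ q′ ∣ ℚ.≤ B → ∣ p ℚ.- p′ ∣ ℚ.≤ δ → ∣ q ℚ.- q′ ∣ ℚ.≤ δ →
    ∣ p ℚ.* q ℚ.- p′ ℚ.* q′ ∣ ℚ.≤ (A ℚ.+ B) ℚ.* δ
  product-close p q p′ q′ A B δ p≤A q′≤B p-p′≤δ q-q′≤δ = begin
    ∣ p ℚ.* q ℚ.- p′ ℚ.* q′ ∣
      ≡⟨ cong ∣_∣ (rearrange p q p′ q′) ⟩
    ∣ p ℚ.* (q ℚ.- q′) ℚ.+ q′ ℚ.* (p ℚ.- p′) ∣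
      ≤⟨ ℚ.∣p+q∣≤∣p∣+∣q∣ (p ℚ.* (q ℚ.- q′)) (q′ ℚ.* (p ℚ.- p′)) ⟩
    ∣ p ℚ.* (q ℚ.- q′) ∣ ℚ.+ ∣ q′ ℚ.* (p ℚ.- p′) ∣
      ≤⟨ ℚ.+-mono-≤
           (∣*∣-mono-≤ p (q ℚ.- q′) A δ p≤A q-q′≤δ)
           (∣*∣-mono-≤ q′ (p ℚ.- p′) B δ q′≤B p-p′≤δ) ⟩
    A ℚ.* δ ℚ.+ B ℚ.* δ
      ≡⟨ ℚ.*-distribʳ-+ δ A B ⟨
    (A ℚ.+ B) ℚ.* δ ∎
    where
    open ℚ.≤-Reasoning
    rearrange : ∀ p q p′ q′ →
      p ℚ.* q ℚ.- p′ ℚ.* q′ ≡ p ℚ.* (q ℚ.- q′) ℚ.+ q′ ℚ.* (p ℚ.- p′)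
    rearrange = solve 4 (λ p q p′ q′ →
      p :* q :- p′ :* q′ := p :* (q :- q′) :+ q′ :* (p :- p′)) refl
      where open +-*-Solver

  *-cauchy : ∀ s t → IsCauchy s → IsCauchy t → IsCauchy (λ n → s n ℚ.* t n)
  *-cauchy s t cs ct ε 0<ε =
    let K , A , 0<A , s≤A = bounded s cs
        L , B , 0<B , t≤B = bounded t ct
        δ , 0<δ , [A+B]δ≡ε = divide (A ℚ.+ B) ε (ℚ.+-mono-< 0<A 0<B) 0<ε
        M , closeₛ = cs δ 0<δ
        N , closeₜ = ct δ 0<δ
    in (K ⊔ L) ⊔ (M ⊔ N) , λ m n p q →
      let KL≤m = ℕ.m⊔n≤o⇒m≤o (K ⊔ L) (M ⊔ N) p
          KL≤n = ℕ.m⊔n≤o⇒m≤o (K ⊔ L) (M ⊔ N) q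
          MN≤m = ℕ.m⊔n≤o⇒n≤o (K ⊔ L) (M ⊔ N) p
          MN≤n = ℕ.m⊔n≤o⇒n≤o (K ⊔ L) (M ⊔ N) q
      in subst (∣ s m ℚ.* t m ℚ.- s n ℚ.* t n ∣ ℚ.≤_) [A+B]δ≡ε
           (product-close (s m) (t m) (s n) (t n) A B δ
             (s≤A m (ℕ.m⊔n≤o⇒m≤o K L KL≤m))
             (t≤B n (ℕ.m⊔n≤o⇒n≤o K L KL≤n))
             (closeₛ m n (ℕ.m⊔n≤o⇒m≤o M N MN≤m) (ℕ.m⊔n≤o⇒m≤o M N MN≤n))
             (closeₜ m n (ℕ.m⊔n≤o⇒n≤o M N MN≤m) (ℕ.m⊔n≤o⇒n≤o M N MN≤n)))

_+_ : ℝ → ℝ → ℝ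
x + y = mkℝ (λ n → seq x n ℚ.+ seq y n)
            (+-cauchy (seq x) (seq y) (cauchy x) (cauchy y))

_*_ : ℝ → ℝ → ℝ
x * y = mkℝ (λ n → seq x n ℚ.* seq y n)
            (*-cauchy (seq x) (seq y) (cauchy x) (cauchy y))

_^_ : ℝ → ℕ → ℝ
x ^ zero  = 1ℝ
x ^ suc n = x * x ^ n

-- r = x ^ (p / q), for a positive real x: the positive q-th root of x ^ p.
IsRationalPower : (r x : ℝ) (p q : ℕ) .{{_ : ℕ.NonZero q}} → Set
IsRationalPower r x p q = 0ℝ < r × r ^ q ≃ x ^ p

------------------------------------------------------------------------
-- Tribonacci sequences.  A sequence ⟨a₁, …, aₖ⟩ is a function on Fin k,
-- so that aᵢ is the value at the index i - 1.

IsTribonacci : ∀ {k} → Vector ℤ k → Set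
IsTribonacci {k} a = ∀ (h i j l : Fin k) →
  toℕ i ≡ 1 ℕ.+ toℕ h → toℕ j ≡ 2 ℕ.+ toℕ h → toℕ l ≡ 3 ℕ.+ toℕ h →
  a l ≡ a j ℤ.+ a i ℤ.+ a h

-- For k < 3 this constrains every term.
IsPositive : ∀ {k} → Vector ℤ k → Set
IsPositive {k} a = ∀ (i : Fin k) → toℕ i ℕ.< 3 → 0ℤ ℤ.< a i

TerminatesAt : ∀ {k} → Vector ℤ k → ℤ → Set
TerminatesAt {k} a n = ∃[ i ] (suc (toℕ i) ≡ k × a i ≡ n)

{-# OPTIONS --safe #-}
module Submission where

-- Run the recursion backwards, b(j+3) = b(j) - b(j+1) - b(j+2), from b(0) = n. A real sequence with
-- positive first terms is available: n / s times the tribonacci sequence 1, 1, 1, 3, 5, …, s of length k.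
-- Rounding its terms b(1) and b(2) to integers perturbs b by e U + f V with |e|, |f| ≤ 1/2, where U and V
-- start with 0, 1, 0 and 0, 0, 1, so all terms stay positive as long as s |U(j) ± V(j)| < 2 n for j < k.
-- Now s is of order φ^k, and the backward sequences U ± V grow only like φ^(j/2), because the roots of
-- x³ = x² + x + 1 other than φ have modulus φ^(-1/2); hence n of order φ^(3k/2) suffices. Concretely
-- 11 s ≤ 3 φ^k, 7 (U ± V)² ≤ 15 φ^k and φ^(3k) ≤ 25 n² give 847 (s (U ± V))² ≤ 3375 n² < 847 (2 n)².

open import Algebra.Bundles using (CommutativeRing)
import Algebra.Properties.Semiring.Exp as Exp
import Algebra.Solver.Ring as RingSolver
open import Algebra.Solver.Ring.AlmostCommutativeRing
  using (fromCommutativeRing; _-Raw-AlmostCommutative⟶_)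
open import Data.Fin as Fin using (Fin; toℕ)
import Data.Fin.Properties as Fin
open import Data.Integer as ℤ using (ℤ; +_; +[1+_]; 0ℤ; 1ℤ)
open import Data.Integer.DivMod using (_/ℕ_; _%ℕ_; n%ℕd<d; a≡a%ℕn+[a/ℕn]*n)
import Data.Integer.Properties as ℤ
open import Data.Integer.Solver using () renaming (module +-*-Solver to ℤ-Solver)
open import Data.Maybe as Maybe using (Maybe)
open import Data.Nat as ℕ using (ℕ; zero; suc; NonZero)
import Data.Nat.Properties as ℕ
open import Data.Product using (∃-syntax; _×_; _,_)
open import Data.Rational as ℚ using (ℚ; 0ℚ; 1ℚ; ½; ∣_∣; _/_)
import Data.Rational.Properties as ℚ
open import Data.Rational.Solver using () renaming (module +-*-Solver to ℚ-Solver)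
import Data.Rational.Unnormalised as ℚᵘ
import Data.Rational.Unnormalised.Properties as ℚᵘₚ
open import Data.Sum using (_⊎_; inj₁; inj₂)
open import Data.Vec.Functional using (Vector)
open import Level using (Level; 0ℓ; _⊔_) renaming (suc to lsuc)
open import Relation.Binary.PropositionalEquality
open import Relation.Nullary.Decidable using (dec⇒maybe)

-- Tribonacci numbers and the backward recursion over the integers.

trib : ℕ → ℤ
trib 0 = 1ℤ
trib 1 = 1ℤ
trib 2 = 1ℤ
trib (suc (suc (suc i))) = trib (suc (suc i)) ℤ.+ trib (suc i) ℤ.+ trib i

back : ℤ → ℤ → ℤ → ℕ → ℤ
back p q r zero    = p
back p q r (suc j) = back q r (p ℤ.- q ℤ.- r) j

0<trib : ∀ i → 0ℤ ℤ.< trib i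
0<trib 0 = ℤ.positive⁻¹ 1ℤ
0<trib 1 = ℤ.positive⁻¹ 1ℤ
0<trib 2 = ℤ.positive⁻¹ 1ℤ
0<trib (suc (suc (suc i))) = ℤ.+-mono-< (ℤ.+-mono-< (0<trib (suc (suc i))) (0<trib (suc i))) (0<trib i)

-- Started at three consecutive tribonacci numbers, the backward recursion retraces `trib` down to
-- index 0, which it reaches at `j` = 2 + `t`.
0<back-trib : ∀ t j → j ℕ.≤ 2 ℕ.+ t → 0ℤ ℤ.< back (trib (2 ℕ.+ t)) (trib (1 ℕ.+ t)) (trib t) j
0<back-trib t zero _ = 0<trib (2 ℕ.+ t)
0<back-trib zero 1 _ = 0<trib 1
0<back-trib zero 2 _ = 0<trib 0
0<back-trib zero (suc (suc (suc _))) (ℕ.s≤s (ℕ.s≤s ()))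
0<back-trib (suc t) (suc j) (ℕ.s≤s j≤2+t) =
  subst (λ r → 0ℤ ℤ.< back (trib (2 ℕ.+ t)) (trib (1 ℕ.+ t)) r j)
    (solve 3 (λ p q r → r := p :+ q :+ r :- p :- q) refl (trib (2 ℕ.+ t)) (trib (1 ℕ.+ t)) (trib t))
    (0<back-trib t j j≤2+t)
  where open ℤ-Solver

back-cong : ∀ {p p′ q q′ r r′} → p ≡ p′ → q ≡ q′ → r ≡ r′ → ∀ j → back p q r j ≡ back p′ q′ r′ j
back-cong refl refl refl j = refl

back-+ : ∀ p q r p′ q′ r′ j →
  back (p ℤ.+ p′) (q ℤ.+ q′) (r ℤ.+ r′) j ≡ back p q r j ℤ.+ back p′ q′ r′ j
back-+ p q r p′ q′ r′ zero = refl
back-+ p q r p′ q′ r′ (suc j) = trans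
  (back-cong {q ℤ.+ q′} refl refl (solve 6 (λ p q r p′ q′ r′ →
    p :+ p′ :- (q :+ q′) :- (r :+ r′) := (p :- q :- r) :+ (p′ :- q′ :- r′)) refl p q r p′ q′ r′) j)
  (back-+ q r (p ℤ.- q ℤ.- r) q′ r′ (p′ ℤ.- q′ ℤ.- r′) j)
  where open ℤ-Solver

back-* : ∀ c p q r j → back (c ℤ.* p) (c ℤ.* q) (c ℤ.* r) j ≡ c ℤ.* back p q r j
back-* c p q r zero = refl
back-* c p q r (suc j) = trans
  (back-cong {c ℤ.* q} refl refl (solve 4 (λ c p q r →
    c :* p :- c :* q :- c :* r := c :* (p :- q :- r)) refl c p q r) j)
  (back-* c q r (p ℤ.- q ℤ.- r) j)
  where open ℤ-Solver

back-recurrence : ∀ p q r m → back p q r m ≡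
  back p q r (1 ℕ.+ m) ℤ.+ back p q r (2 ℕ.+ m) ℤ.+ back p q r (3 ℕ.+ m)
back-recurrence p q r zero = solve 3 (λ p q r → p := q :+ r :+ (p :- q :- r)) refl p q r
  where open ℤ-Solver
back-recurrence p q r (suc m) = back-recurrence q r (p ℤ.- q ℤ.- r) m

-- Rounding to integer starting values and control of the error.

-- `x` is a / s rounded to a nearest integer, the floor of (2 a + s) / (2 s). Everything is doubled
-- so that the rounding error 1/2 becomes |e| ≤ s over the integers.
nearest-multiple : ∀ s a → 0ℤ ℤ.< s →
  ∃[ x ] ∃[ e ] (+ 2 ℤ.* s ℤ.* x ≡ + 2 ℤ.* a ℤ.+ e × ℤ.- s ℤ.≤ e × e ℤ.≤ s)
nearest-multiple (+ zero) a (ℤ.+<+ ())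
nearest-multiple s@(+[1+ m ]) a _ = x , s ℤ.- + ρ ,
  (begin
    + 2 ℤ.* s ℤ.* x
      ≡⟨ solve 3 (λ s x ρ → con (+ 2) :* s :* x := ρ :+ x :* (con (+ 2) :* s) :- ρ) refl s x (+ ρ) ⟩
    + ρ ℤ.+ x ℤ.* (+ 2 ℤ.* s) ℤ.- + ρ
      ≡⟨ cong (ℤ._- + ρ) (a≡a%ℕn+[a/ℕn]*n (+ 2 ℤ.* a ℤ.+ s) (2 ℕ.* suc m)) ⟨
    + 2 ℤ.* a ℤ.+ s ℤ.- + ρ
      ≡⟨ ℤ.+-assoc (+ 2 ℤ.* a) s (ℤ.- + ρ) ⟩
    + 2 ℤ.* a ℤ.+ (s ℤ.- + ρ) ∎) ,
  (subst (ℤ._≤ s ℤ.- + ρ) (solve 1 (λ s → s :- con (+ 2) :* s := :- s) refl s)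
    (ℤ.+-monoʳ-≤ s (ℤ.neg-mono-≤ (ℤ.<⇒≤ (ℤ.+<+ (n%ℕd<d (+ 2 ℤ.* a ℤ.+ s) (2 ℕ.* suc m))))))) ,
  ℤ.i-j≤i s (+ ρ)
  where
  open ≡-Reasoning
  open ℤ-Solver
  x = (+ 2 ℤ.* a ℤ.+ s) /ℕ (2 ℕ.* suc m)
  ρ = (+ 2 ℤ.* a ℤ.+ s) %ℕ (2 ℕ.* suc m)

private
  ±su≤eu : ∀ {s e} u → ℤ.- s ℤ.≤ e → e ℤ.≤ s → ℤ.- (s ℤ.* u) ℤ.≤ e ℤ.* u ⊎ s ℤ.* u ℤ.≤ e ℤ.* u
  ±su≤eu {s} {e} u -s≤e e≤s with ℤ.≤-total 0ℤ u
  ... | inj₁ 0≤u = inj₁ (subst (ℤ._≤ e ℤ.* u) (sym (ℤ.neg-distribˡ-* s u))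
          (ℤ.*-monoʳ-≤-nonNeg u {{ℤ.nonNegative 0≤u}} -s≤e))
  ... | inj₂ u≤0 = inj₂ (ℤ.*-monoʳ-≤-nonPos u {{ℤ.nonPositive u≤0}} e≤s)

-- For |e|, |f| ≤ s the minimum of e u + f v is attained at a corner (± s, ± s).
-M<eu+fv : ∀ {M s e f} u v → ℤ.- s ℤ.≤ e → e ℤ.≤ s → ℤ.- s ℤ.≤ f → f ℤ.≤ s →
  (∀ c → c ≡ 1ℤ ⊎ c ≡ ℤ.- 1ℤ →
    ℤ.- M ℤ.< s ℤ.* (u ℤ.+ c ℤ.* v) × s ℤ.* (u ℤ.+ c ℤ.* v) ℤ.< M) →
  ℤ.- M ℤ.< e ℤ.* u ℤ.+ f ℤ.* v
-M<eu+fv {M} {s} {e} {f} u v -s≤e e≤s -s≤f f≤s corners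
  with ±su≤eu u -s≤e e≤s | ±su≤eu v -s≤f f≤s
     | corners 1ℤ (inj₁ refl) | corners (ℤ.- 1ℤ) (inj₂ refl)
... | inj₁ p | inj₁ q | _ , +<M | _ = ℤ.<-≤-trans (subst (ℤ.- M ℤ.<_)
        (solve 3 (λ s u v → :- (s :* (u :+ con 1ℤ :* v)) := :- (s :* u) :+ :- (s :* v)) refl s u v)
        (ℤ.neg-mono-< +<M)) (ℤ.+-mono-≤ p q)
  where open ℤ-Solver
... | inj₁ p | inj₂ q | _ | _ , -<M = ℤ.<-≤-trans (subst (ℤ.- M ℤ.<_)
        (solve 3 (λ s u v → :- (s :* (u :+ con (ℤ.- 1ℤ) :* v)) := :- (s :* u) :+ s :* v) refl s u v)
        (ℤ.neg-mono-< -<M)) (ℤ.+-mono-≤ p q)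
  where open ℤ-Solver
... | inj₂ p | inj₁ q | _ | -M<- , _ = ℤ.<-≤-trans (subst (ℤ.- M ℤ.<_)
        (solve 3 (λ s u v → s :* (u :+ con (ℤ.- 1ℤ) :* v) := s :* u :+ :- (s :* v)) refl s u v)
        -M<-) (ℤ.+-mono-≤ p q)
  where open ℤ-Solver
... | inj₂ p | inj₂ q | -M<+ , _ | _ = ℤ.<-≤-trans (subst (ℤ.- M ℤ.<_)
        (solve 3 (λ s u v → s :* (u :+ con 1ℤ :* v) := s :* u :+ s :* v) refl s u v)
        -M<+) (ℤ.+-mono-≤ p q)
  where open ℤ-Solver

-- If w ≥ 2 n, then 847 w² ≥ 3388 n², and 3388 n² exceeds 3375 n² by 13 n² > 0.
w<2n : ∀ {n w} → 0ℤ ℤ.< n → + 847 ℤ.* (w ℤ.* w) ℤ.≤ + 3375 ℤ.* (n ℤ.* n) → w ℤ.< + 2 ℤ.* n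
w<2n {n} {w} 0<n 847w²≤3375n² = ℤ.≰⇒> λ 2n≤w → ℤ.<⇒≱ 3375n²<847[2n]² (ℤ.≤-trans
  (ℤ.*-monoˡ-≤-nonNeg (+ 847) (ℤ.≤-trans
    (ℤ.*-monoˡ-≤-nonNeg (+ 2 ℤ.* n) {{ℤ.nonNegative 0≤2n}} 2n≤w)
    (ℤ.*-monoʳ-≤-nonNeg w {{ℤ.nonNegative (ℤ.≤-trans 0≤2n 2n≤w)}} 2n≤w)))
  847w²≤3375n²)
  where
  open ℤ-Solver
  instance
    n-pos : ℤ.Positive n
    n-pos = ℤ.positive 0<n
  0≤2n : 0ℤ ℤ.≤ + 2 ℤ.* n
  0≤2n = ℤ.*-monoˡ-≤-nonNeg (+ 2) (ℤ.<⇒≤ 0<n)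
  0<13n² : 0ℤ ℤ.< + 13 ℤ.* (n ℤ.* n)
  0<13n² = ℤ.*-monoˡ-<-pos (+ 13) (ℤ.*-monoʳ-<-pos n 0<n)
  3375n²<847[2n]² : + 3375 ℤ.* (n ℤ.* n) ℤ.< + 847 ℤ.* ((+ 2 ℤ.* n) ℤ.* (+ 2 ℤ.* n))
  3375n²<847[2n]² = subst₂ ℤ._<_
    (ℤ.+-identityʳ (+ 3375 ℤ.* (n ℤ.* n)))
    (solve 1 (λ n → con (+ 3375) :* (n :* n) :+ con (+ 13) :* (n :* n)
                 := con (+ 847) :* ((con (+ 2) :* n) :* (con (+ 2) :* n))) refl n)
    (ℤ.+-monoʳ-< (+ 3375 ℤ.* (n ℤ.* n)) 0<13n²)

∣w∣<2n : ∀ {n w} → 0ℤ ℤ.< n → + 847 ℤ.* (w ℤ.* w) ℤ.≤ + 3375 ℤ.* (n ℤ.* n) →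
  ℤ.- (+ 2 ℤ.* n) ℤ.< w × w ℤ.< + 2 ℤ.* n
∣w∣<2n {n} {w} 0<n 847w²≤3375n² =
  subst (ℤ.- (+ 2 ℤ.* n) ℤ.<_) (ℤ.neg-involutive w) (ℤ.neg-mono-< (w<2n {n} {ℤ.- w} 0<n
    (subst (λ z → + 847 ℤ.* z ℤ.≤ + 3375 ℤ.* (n ℤ.* n))
      (solve 1 (λ w → w :* w := (:- w) :* (:- w)) refl w) 847w²≤3375n²))) ,
  w<2n 0<n 847w²≤3375n²
  where open ℤ-Solver

-- The corners U ± V are themselves backward sequences, with start 0, 1, `c`, so their growth can be
-- bounded one sequence at a time.
back[0,1,c] : ∀ c → c ≡ 1ℤ ⊎ c ≡ ℤ.- 1ℤ → ∀ j →
  back 0ℤ 1ℤ c j ≡ back 0ℤ 1ℤ 0ℤ j ℤ.+ c ℤ.* back 0ℤ 0ℤ 1ℤ j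
back[0,1,c] c c≡±1 j = trans (split c≡±1)
  (trans (back-+ 0ℤ 1ℤ 0ℤ (c ℤ.* 0ℤ) (c ℤ.* 0ℤ) (c ℤ.* 1ℤ) j)
    (cong (λ z → back 0ℤ 1ℤ 0ℤ j ℤ.+ z) (back-* c 0ℤ 0ℤ 1ℤ j)))
  where
  split : c ≡ 1ℤ ⊎ c ≡ ℤ.- 1ℤ →
    back 0ℤ 1ℤ c j ≡ back (0ℤ ℤ.+ c ℤ.* 0ℤ) (1ℤ ℤ.+ c ℤ.* 0ℤ) (0ℤ ℤ.+ c ℤ.* 1ℤ) j
  -- The products with `c` reduce only once the sign is a literal.
  split (inj₁ refl) = refl
  split (inj₂ refl) = refl

-- Linearity of the recursion in its start, used with `N` = 2 s and `M` = 2 n. The first term `n` is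
-- exact, so errors enter only at the second and third terms and propagate along U and V.
back-expand : ∀ N M g₂ g₁ g₀ n x y e f → N ℤ.* n ≡ M ℤ.* g₂ → N ℤ.* x ≡ M ℤ.* g₁ ℤ.+ e →
  N ℤ.* y ≡ M ℤ.* g₀ ℤ.+ f → ∀ j → N ℤ.* back n x y j
    ≡ M ℤ.* back g₂ g₁ g₀ j ℤ.+ (e ℤ.* back 0ℤ 1ℤ 0ℤ j ℤ.+ f ℤ.* back 0ℤ 0ℤ 1ℤ j)
back-expand N M g₂ g₁ g₀ n x y e f Nn≡ Nx≡ Ny≡ j = begin
  N ℤ.* back n x y j
    ≡⟨ back-* N n x y j ⟨
  back (N ℤ.* n) (N ℤ.* x) (N ℤ.* y) j
    ≡⟨ back-cong
         (trans Nn≡ (solve 3 (λ a e f → a := a :+ (e :* con 0ℤ :+ f :* con 0ℤ)) refl (M ℤ.* g₂) e f))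
         (trans Nx≡ (solve 3 (λ a e f → a :+ e := a :+ (e :* con 1ℤ :+ f :* con 0ℤ)) refl (M ℤ.* g₁) e f))
         (trans Ny≡ (solve 3 (λ a e f → a :+ f := a :+ (e :* con 0ℤ :+ f :* con 1ℤ)) refl (M ℤ.* g₀) e f))
         j ⟩
  back (M ℤ.* g₂ ℤ.+ (e ℤ.* 0ℤ ℤ.+ f ℤ.* 0ℤ)) (M ℤ.* g₁ ℤ.+ (e ℤ.* 1ℤ ℤ.+ f ℤ.* 0ℤ))
       (M ℤ.* g₀ ℤ.+ (e ℤ.* 0ℤ ℤ.+ f ℤ.* 1ℤ)) j
    ≡⟨ back-+ (M ℤ.* g₂) (M ℤ.* g₁) (M ℤ.* g₀) _ _ _ j ⟩
  back (M ℤ.* g₂) (M ℤ.* g₁) (M ℤ.* g₀) j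
    ℤ.+ back (e ℤ.* 0ℤ ℤ.+ f ℤ.* 0ℤ) (e ℤ.* 1ℤ ℤ.+ f ℤ.* 0ℤ) (e ℤ.* 0ℤ ℤ.+ f ℤ.* 1ℤ) j
    ≡⟨ cong₂ ℤ._+_ (back-* M g₂ g₁ g₀ j)
         (trans (back-+ (e ℤ.* 0ℤ) (e ℤ.* 1ℤ) (e ℤ.* 0ℤ) _ _ _ j)
           (cong₂ ℤ._+_ (back-* e 0ℤ 1ℤ 0ℤ j) (back-* f 0ℤ 0ℤ 1ℤ j))) ⟩
  M ℤ.* back g₂ g₁ g₀ j ℤ.+ (e ℤ.* back 0ℤ 1ℤ 0ℤ j ℤ.+ f ℤ.* back 0ℤ 0ℤ 1ℤ j) ∎
  where
  open ≡-Reasoning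
  open ℤ-Solver

-- Integrality gives `g` ≥ 1, so the main term is at least `M` and an error above `- M` cannot
-- cancel it.
0<Mg+b : ∀ {M g b} → 0ℤ ℤ.< M → 0ℤ ℤ.< g → ℤ.- M ℤ.< b → 0ℤ ℤ.< M ℤ.* g ℤ.+ b
0<Mg+b {M} {g} {b} 0<M 0<g -M<b = subst (ℤ._< M ℤ.* g ℤ.+ b) (ℤ.+-inverseʳ M)
  (ℤ.+-mono-≤-< (subst (ℤ._≤ M ℤ.* g) (ℤ.*-identityʳ M)
    (ℤ.*-monoˡ-≤-nonNeg M {{ℤ.nonNegative (ℤ.<⇒≤ 0<M)}} (ℤ.i<j⇒suc[i]≤j 0<g))) -M<b)

-- `x` and `y` round the exact values n trib (1 + t) / s and n trib t / s. After multiplication by 2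
-- s each term is 2 n times a tribonacci number plus e U + f V, and `bound` keeps the latter above -
-- 2 n.
0<back-rounded : ∀ t n → 0ℤ ℤ.< n →
  (∀ c → c ≡ 1ℤ ⊎ c ≡ ℤ.- 1ℤ → ∀ j → j ℕ.≤ 2 ℕ.+ t →
    + 847 ℤ.* ((trib (2 ℕ.+ t) ℤ.* back 0ℤ 1ℤ c j) ℤ.* (trib (2 ℕ.+ t) ℤ.* back 0ℤ 1ℤ c j))
      ℤ.≤ + 3375 ℤ.* (n ℤ.* n)) →
  ∃[ x ] ∃[ y ] (∀ j → j ℕ.≤ 2 ℕ.+ t → 0ℤ ℤ.< back n x y j)
0<back-rounded t n 0<n bound =
  let x , e , 2sx≡ , -s≤e , e≤s = nearest-multiple s (n ℤ.* trib (1 ℕ.+ t)) (0<trib (2 ℕ.+ t))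
      y , f , 2sy≡ , -s≤f , f≤s = nearest-multiple s (n ℤ.* trib t) (0<trib (2 ℕ.+ t))
  in x , y , λ j j≤2+t → ℤ.*-cancelˡ-<-nonNeg (+ 2 ℤ.* s) {{ℤ.nonNegative (ℤ.<⇒≤ (0<2* (0<trib (2 ℕ.+ t))))}}
    (subst₂ ℤ._<_ (sym (ℤ.*-zeroʳ (+ 2 ℤ.* s)))
      (sym (back-expand (+ 2 ℤ.* s) (+ 2 ℤ.* n) s (trib (1 ℕ.+ t)) (trib t) n x y e f
        (trans (ℤ.*-assoc (+ 2) s n) (trans (cong (+ 2 ℤ.*_) (ℤ.*-comm s n)) (sym (ℤ.*-assoc (+ 2) n s))))
        (trans 2sx≡ (cong (ℤ._+ e) (sym (ℤ.*-assoc (+ 2) n (trib (1 ℕ.+ t))))))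
        (trans 2sy≡ (cong (ℤ._+ f) (sym (ℤ.*-assoc (+ 2) n (trib t))))) j))
      (0<Mg+b (0<2* 0<n) (0<back-trib t j j≤2+t)
        (-M<eu+fv (back 0ℤ 1ℤ 0ℤ j) (back 0ℤ 0ℤ 1ℤ j) -s≤e e≤s -s≤f f≤s
          λ c c≡±1 → subst (λ w → ℤ.- (+ 2 ℤ.* n) ℤ.< s ℤ.* w × s ℤ.* w ℤ.< + 2 ℤ.* n)
            (back[0,1,c] c c≡±1 j) (∣w∣<2n 0<n (bound c c≡±1 j j≤2+t)))))
  where
  s = trib (2 ℕ.+ t)
  0<2* : ∀ {i} → 0ℤ ℤ.< i → 0ℤ ℤ.< + 2 ℤ.* i
  0<2* = ℤ.*-monoˡ-<-pos (+ 2)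

-- Polynomial inequalities in φ over a ring with a positive cone.

-- The order of the reals, reduced to rules for nonnegative elements: `nonNeg-cancel` clears
-- positive integer factors, and `nonNeg-ι⁻¹` returns the final inequality to the integers. The
-- abstraction keeps Cauchy sequences out of the polynomial identities.
record PositiveCone {c ℓ} (R : CommutativeRing c ℓ) (p : Level) : Set (c ⊔ ℓ ⊔ lsuc p) where
  open CommutativeRing R
  field
    ℤ⟶R         : ℤ.+-*-rawRing -Raw-AlmostCommutative⟶ fromCommutativeRing R
  open _-Raw-AlmostCommutative⟶_ ℤ⟶R public renaming (⟦_⟧ to ι)
  field
    NonNeg        : Carrier → Set p
    nonNeg-resp-≈ : ∀ {x y} → x ≈ y → NonNeg x → NonNeg y
    nonNeg-+      : ∀ {x y} → NonNeg x → NonNeg y → NonNeg (x + y)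
    nonNeg-*      : ∀ {x y} → NonNeg x → NonNeg y → NonNeg (x * y)
    nonNeg-x*x    : ∀ x → NonNeg (x * x)
    nonNeg-ι      : ∀ {z} → 0ℤ ℤ.≤ z → NonNeg (ι z)
    nonNeg-ι⁻¹    : ∀ z → NonNeg (ι z) → 0ℤ ℤ.≤ z
    nonNeg-cancel : ∀ n {x} .{{_ : NonZero n}} → NonNeg (ι (+ n) * x) → NonNeg x

-- Inequalities are stated as NonNeg of a difference and proved by writing a multiple of the difference as a
-- combination of nonnegative terms, modulo the equation of φ.
module TribonacciBounds {c ℓ p} {R : CommutativeRing c ℓ} (cone : PositiveCone R p) where
  open CommutativeRing R hiding (zero; refl; sym; trans)
  open CommutativeRing R using () renaming (refl to ≈-refl; sym to ≈-sym; trans to ≈-trans)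
  open PositiveCone cone
  open Exp semiring using (_^_; ^-homo-*; ^-congʳ)

  private
    ι≟ : ∀ i j → Maybe (ι i ≈ ι j)
    ι≟ i j = Maybe.map (λ { refl → ≈-refl }) (dec⇒maybe (i ℤ.≟ j))

  open RingSolver ℤ.+-*-rawRing (fromCommutativeRing R) ℤ⟶R ι≟

  infixl 6 _⊹_
  infixl 7 _·_

  private
    _⊹_ : ∀ {x y} → NonNeg x → NonNeg y → NonNeg (x + y)
    _⊹_ = nonNeg-+

    _·_ : ∀ {x y} → NonNeg x → NonNeg y → NonNeg (x * y)
    _·_ = nonNeg-*

    pos : ∀ n → NonNeg (ι (+ n))
    pos n = nonNeg-ι (ℤ.+≤+ ℕ.z≤n)

    κ : ∀ {m} → ℕ → Polynomial m
    κ n = con (+ n)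

  -- 25 n² - r² = (5 n - r) (5 n + r), with the second factor written as (5 n - r) + 2 r. For r =
  -- φ^(3k/2) this removes the square root from the hypothesis on n.
  r²≤25n² : ∀ n u r F → ι (+ 5) * u ≈ r → r ^ 2 ≈ F → NonNeg r → NonNeg (n - u) →
    NonNeg (ι (+ 25) * (n * n) - F)
  r²≤25n² n u r F 5u≈r r²≈F 0≤r u≤n = nonNeg-resp-≈
    (+-congˡ (-‿cong r²≈F))
    (nonNeg-resp-≈
      (solve 2 (λ n r → (κ 5 :* n :- r) :* ((κ 5 :* n :- r) :+ κ 2 :* r) := κ 25 :* (n :* n) :- r :^ 2)
        ≈-refl n r)
      (r≤5n · (r≤5n ⊹ pos 2 · 0≤r)))
    where
    r≤5n : NonNeg (ι (+ 5) * n - r)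
    r≤5n = nonNeg-resp-≈ (≈-trans
      (solve 2 (λ n u → κ 5 :* (n :- u) := κ 5 :* n :- κ 5 :* u) ≈-refl n u)
      (+-congˡ (-‿cong 5u≈r))) (pos 5 · u≤n)

  module _ (φ : Carrier)
           (φ-root : φ ^ 3 ≈ φ ^ 2 + φ + 1#)
           (6φ≥11 : NonNeg (ι (+ 6) * φ - ι (+ 11)))
           (20φ≤37 : NonNeg (ι (+ 37) - ι (+ 20) * φ)) where

    private
      χ : ∀ {m} → Polynomial m → Polynomial m
      χ x = x :* x :* x :- x :* x :- x :- κ 1

      -- The bounds 11/6 ≤ φ ≤ 37/20 as polynomials; the certificates below are nonnegative
      -- combinations built from them.
      A B : ∀ {m} → Polynomial m → Polynomial m
      A x = κ 6 :* x :- κ 11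
      B x = κ 37 :- κ 20 :* x

      E : Carrier
      E = φ * φ * φ - φ * φ - φ - ι (+ 1)

      E≈0 : E ≈ 0#
      E≈0 = ≈-trans (solve 1 (λ x → χ x := x :^ 3 :- (x :^ 2 :+ x :+ κ 1)) ≈-refl φ)
        (≈-trans (+-congˡ (-‿cong (+-congˡ 1-homo)))
          (≈-trans (+-congʳ φ-root) (-‿inverseʳ _)))

      -- The solver proves identities of free polynomials only. One that holds modulo the cubic is
      -- given to it with an explicit cofactor `z` of `E`, and that multiple is dropped here.
      mod-E : ∀ {x y} z → x ≈ y + E * z → x ≈ y
      mod-E {x} {y} z x≈y+Ez = ≈-trans x≈y+Ez
        (≈-trans (+-congˡ (≈-trans (*-congʳ E≈0) (zeroˡ z))) (+-identityʳ y))

    φ≥0 : NonNeg φ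
    φ≥0 = nonNeg-cancel 6 (nonNeg-resp-≈
      (solve 1 (λ x → A x :+ κ 11 := κ 6 :* x) ≈-refl φ) (6φ≥11 ⊹ pos 11))

    -- Expansion of 216 φ³ in powers of 6 φ - 11; the constant term is 11³ = 1331 = 216 · 6 + 35.
    φ³≥6 : NonNeg (φ * φ * φ - ι (+ 6))
    φ³≥6 = nonNeg-cancel 216 (nonNeg-resp-≈
      (solve 1 (λ x → A x :* A x :* A x :+ κ 33 :* (A x :* A x) :+ κ 363 :* A x :+ κ 35
                      := κ 216 :* (x :* x :* x :- κ 6)) ≈-refl φ)
      (6φ≥11 · 6φ≥11 · 6φ≥11 ⊹ pos 33 · (6φ≥11 · 6φ≥11) ⊹ pos 363 · 6φ≥11 ⊹ pos 35))

    φ≥1 : NonNeg (φ - ι (+ 1))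
    φ≥1 = nonNeg-cancel 6 (nonNeg-resp-≈
      (solve 1 (λ x → A x :+ κ 5 := κ 6 :* (x :- κ 1)) ≈-refl φ) (6φ≥11 ⊹ pos 5))

    φ^n≥0 : ∀ n → NonNeg (φ ^ n)
    φ^n≥0 zero    = nonNeg-resp-≈ 1-homo (pos 1)
    φ^n≥0 (suc n) = φ≥0 · φ^n≥0 n

    φ^-mono : ∀ {m n} → m ℕ.≤ n → NonNeg (φ ^ n - φ ^ m)
    φ^-mono {zero} {zero} _ = nonNeg-resp-≈ (solve 1 (λ x → κ 0 := x :- x) ≈-refl (φ ^ 0)) (pos 0)
    φ^-mono {zero} {suc n} _ = nonNeg-resp-≈
      (solve 3 (λ x y z → (x :- κ 1) :* y :+ (y :- z) := x :* y :- z) ≈-refl φ (φ ^ n) (φ ^ 0))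
      (φ≥1 · φ^n≥0 n ⊹ φ^-mono {zero} {n} ℕ.z≤n)
    φ^-mono {suc m} {suc n} (ℕ.s≤s m≤n) = nonNeg-resp-≈
      (solve 3 (λ x y z → x :* (y :- z) := x :* y :- x :* z) ≈-refl φ (φ ^ n) (φ ^ m))
      (φ≥0 · φ^-mono m≤n)

    -- Growth of the forward and the backward sequences.

    -- Both sides obey the tribonacci recursion, so three base cases suffice. The constants fit t =
    -- 1 exactly: 3 φ⁴ ≥ 18 φ ≥ 33 = 11 · 3.
    11trib≤3φ^ : ∀ t → NonNeg (ι (+ 3) * φ ^ (3 ℕ.+ t) - ι (+ 11) * ι (trib (2 ℕ.+ t)))
    11trib≤3φ^ 0 = nonNeg-resp-≈
      (solve 1 (λ x → κ 3 :* (x :* x :* x :- κ 6) :+ κ 7 := κ 3 :* x :^ 3 :- κ 11 :* κ 1)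
        ≈-refl φ)
      (pos 3 · φ³≥6 ⊹ pos 7)
    11trib≤3φ^ 1 = nonNeg-resp-≈
      (solve 1 (λ x → κ 3 :* (x :* (x :* x :* x :- κ 6) :+ A x) := κ 3 :* x :^ 4 :- κ 11 :* κ 3)
        ≈-refl φ)
      (pos 3 · (φ≥0 · φ³≥6 ⊹ 6φ≥11))
    11trib≤3φ^ 2 = nonNeg-cancel 2 (nonNeg-resp-≈
      (solve 1 (λ x → κ 6 :* (x :* x :* (x :* x :* x :- κ 6)) :+ (A x :* A x :+ κ 22 :* A x :+ κ 11)
                      := κ 2 :* (κ 3 :* x :^ 5 :- κ 11 :* κ 5)) ≈-refl φ)
      (pos 6 · (φ≥0 · φ≥0 · φ³≥6) ⊹ (6φ≥11 · 6φ≥11 ⊹ pos 22 · 6φ≥11 ⊹ pos 11)))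
    11trib≤3φ^ (suc (suc (suc t))) = nonNeg-resp-≈
      (mod-E (- (ι (+ 3) * φ ^ (3 ℕ.+ t))) (≈-trans
        (solve 5 (λ x y u v w →
            (κ 3 :* (x :* (x :* y)) :- κ 11 :* u)
              :+ (κ 3 :* (x :* y) :- κ 11 :* v)
              :+ (κ 3 :* y :- κ 11 :* w)
            := (κ 3 :* (x :* (x :* (x :* y))) :- κ 11 :* (u :+ v :+ w)) :+ χ x :* (:- (κ 3 :* y)))
          ≈-refl φ (φ ^ (3 ℕ.+ t)) (ι (trib (4 ℕ.+ t))) (ι (trib (3 ℕ.+ t))) (ι (trib (2 ℕ.+ t))))
        (+-congʳ (+-congˡ (-‿cong (*-congˡ (≈-sym
          (≈-trans (+-homo (trib (4 ℕ.+ t) ℤ.+ trib (3 ℕ.+ t)) (trib (2 ℕ.+ t)))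
            (+-congʳ (+-homo (trib (4 ℕ.+ t)) (trib (3 ℕ.+ t))))))))))))
      (11trib≤3φ^ (suc (suc t)) ⊹ 11trib≤3φ^ (suc t) ⊹ 11trib≤3φ^ t)

    -- The backward recursion has the characteristic root 1/φ, which d kills, and two conjugate roots with
    -- product φ; norm is, up to a constant, the squared modulus of the component along those two.
    d : Carrier → Carrier → Carrier
    d x y = x - φ * y

    norm : Carrier → Carrier → Carrier → Carrier
    norm x y z = φ * (d x y * d x y) + (φ * φ - φ) * (d x y * d y z) + d y z * d y z

    private
      D : ∀ {m} → Polynomial m → Polynomial m → Polynomial m → Polynomial m
      D f x y = x :- f :* y

      N : ∀ {m} → Polynomial m → Polynomial m → Polynomial m → Polynomial m → Polynomial m
      N f x y z = f :* (D f x y :* D f x y) :+ (f :* f :- f) :* (D f x y :* D f y z)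
        :+ D f y z :* D f y z

    norm-cong : ∀ {z z′} x y → z ≈ z′ → norm x y z ≈ norm x y z′
    norm-cong x y z≈z′ = +-cong (+-congˡ (*-congˡ (*-congˡ d≈d))) (*-cong d≈d d≈d)
      where d≈d = +-congˡ (-‿cong (*-congˡ z≈z′))

    -- Modulo the cubic, consecutive values u, v, w of `d` satisfy w = - φ u - (φ² - φ) v. The form
    -- φ u² + (φ² - φ) u v + v² is the norm form of t² + (φ² - φ) t + φ, so a step multiplies it by
    -- the constant term φ.
    norm-step : ∀ x y z → norm y z (x - y - z) ≈ φ * norm x y z
    norm-step x y z = mod-E
      -- The new value of `d` is off by - E z before reduction; squaring it puts E z² into the
      -- cofactor.
      (z * (φ * d x y + ((φ * φ - φ) * d y z + φ * d x y)) + (φ * φ * φ - φ * φ - φ - ι (+ 1)) * (z * z))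
      (solve 4 (λ f x y z → N f y z (x :- y :- z) := f :* N f x y z :+ χ f :*
        (z :* (f :* D f x y :+ ((f :* f :- f) :* D f y z :+ f :* D f x y)) :+ χ f :* (z :* z)))
        ≈-refl φ x y z)

    -- norm is a square plus (4 φ + 1 - φ²) d² / 4, and 4 φ + 1 - φ² ≥ 24/5 for 11/6 ≤ φ ≤ 37/20.
    6d²≤5norm : ∀ x y z → NonNeg (ι (+ 5) * norm x y z - ι (+ 6) * (d x y * d x y))
    6d²≤5norm x y z = nonNeg-cancel 288 (nonNeg-resp-≈
      (mod-E (ι (+ 360) * (φ - ι (+ 1)) * (d x y * d x y))
        (solve 3 (λ f u v → κ 360 :* ((κ 2 :* v :+ (f :* f :- f) :* u) :* (κ 2 :* v :+ (f :* f :- f) :* u))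
            :+ (κ 3 :* (A f :* B f) :+ κ 19 :* A f :+ κ 62) :* (u :* u)
          := κ 288 :* (κ 5 :* (f :* (u :* u) :+ (f :* f :- f) :* (u :* v) :+ v :* v) :- κ 6 :* (u :* u))
            :+ χ f :* (κ 360 :* (f :- κ 1) :* (u :* u)))
          ≈-refl φ (d x y) (d y z)))
      (pos 360 · nonNeg-x*x _ ⊹ (pos 3 · (6φ≥11 · 20φ≤37) ⊹ pos 19 · 6φ≥11 ⊹ pos 62) · nonNeg-x*x _))

    norm≥0 : ∀ x y z → NonNeg (norm x y z)
    norm≥0 x y z = nonNeg-cancel 5 (nonNeg-resp-≈
      (solve 2 (λ q u → (κ 5 :* q :- κ 6 :* u) :+ κ 6 :* u := κ 5 :* q) ≈-refl (norm x y z) (d x y * d x y))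
      (6d²≤5norm x y z ⊹ pos 6 · nonNeg-x*x (d x y)))

    -- φ y = x - d x y gives φ² y² ≤ 2 x² + 2 d², and 12 (2 x² + 2 d²) ≤ 30 norm ≤ 5 φ³ norm.
    -- The factor φ² is removed by multiplying with the square of φ² - φ - 1 = 1/φ.
    12x²≤5norm-step : ∀ x y z → NonNeg (ι (+ 5) * norm x y z - ι (+ 12) * (x * x)) →
      NonNeg (ι (+ 5) * norm y z (x - y - z) - ι (+ 12) * (y * y))
    12x²≤5norm-step x y z 12x²≤5norm = nonNeg-resp-≈
      (≈-trans
        (mod-E ((ι (+ 2) + E) * (ι (+ 5) * (φ * norm x y z) - ι (+ 12) * (y * y)))
          (solve 4 (λ f x y q →
              (f :* f :- f :- κ 1) :* (f :* f :- f :- κ 1) :*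
                (κ 2 :* (κ 5 :* q :- κ 12 :* (x :* x))
                  :+ κ 4 :* (κ 5 :* q :- κ 6 :* (D f x y :* D f x y))
                  :+ κ 12 :* ((x :+ D f x y) :* (x :+ D f x y))
                  :+ κ 5 :* (f :* f :* f :- κ 6) :* q)
              := (κ 5 :* (f :* q) :- κ 12 :* (y :* y))
                :+ χ f :* ((κ 2 :+ χ f) :* (κ 5 :* (f :* q) :- κ 12 :* (y :* y))))
            ≈-refl φ x y (norm x y z)))
        (+-congʳ (*-congˡ (≈-sym (norm-step x y z)))))
      (nonNeg-x*x (φ * φ - φ - ι (+ 1)) ·
        (pos 2 · 12x²≤5norm ⊹ pos 4 · 6d²≤5norm x y z ⊹ pos 12 · nonNeg-x*x _
          ⊹ pos 5 · φ³≥6 · norm≥0 x y z))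

    ι-back-step : ∀ p q r → ι (p ℤ.- q ℤ.- r) ≈ ι p - ι q - ι r
    ι-back-step p q r = ≈-trans (+-homo (p ℤ.- q) (ℤ.- r))
      (+-cong (≈-trans (+-homo p (ℤ.- q)) (+-congˡ (-‿homo q))) (-‿homo r))

    -- The hypothesis is an invariant of the recursion by `12x²≤5norm-step`, while each step
    -- contributes one factor φ to the norm.
    12back²≤5φ^norm : ∀ j p q r →
      NonNeg (ι (+ 5) * norm (ι p) (ι q) (ι r) - ι (+ 12) * (ι p * ι p)) →
      NonNeg (ι (+ 5) * (φ ^ j * norm (ι p) (ι q) (ι r))
              - ι (+ 12) * (ι (back p q r j) * ι (back p q r j)))
    12back²≤5φ^norm zero p q r h = nonNeg-resp-≈
      (+-congʳ (*-congˡ (≈-sym (*-identityˡ _)))) h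
    12back²≤5φ^norm (suc j) p q r h = nonNeg-resp-≈
      (+-congʳ (*-congˡ (≈-trans (*-congˡ norm′)
        (solve 3 (λ x y z → y :* (x :* z) := x :* y :* z) ≈-refl φ (φ ^ j) (norm (ι p) (ι q) (ι r))))))
      (12back²≤5φ^norm j q r (p ℤ.- q ℤ.- r)
        (nonNeg-resp-≈ (+-congʳ (*-congˡ (norm-cong (ι q) (ι r) (≈-sym (ι-back-step p q r)))))
          (12x²≤5norm-step (ι p) (ι q) (ι r) h)))
      where
      norm′ : norm (ι q) (ι r) (ι (p ℤ.- q ℤ.- r)) ≈ φ * norm (ι p) (ι q) (ι r)
      norm′ = ≈-trans (norm-cong (ι q) (ι r) (ι-back-step p q r)) (norm-step (ι p) (ι q) (ι r))

    -- 12 b² ≤ 5 φ^j norm and 7 norm ≤ 36 φ combine, as 5 · 36 = 12 · 15. The invariant holds at the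
    -- start because the first term is 0.
    7back²≤15φ^ : ∀ j s → NonNeg (ι (+ 36) * φ - ι (+ 7) * norm (ι 0ℤ) (ι 1ℤ) (ι s)) →
      NonNeg (ι (+ 15) * φ ^ suc j - ι (+ 7) * (ι (back 0ℤ 1ℤ s j) * ι (back 0ℤ 1ℤ s j)))
    7back²≤15φ^ j s 7norm≤36φ = nonNeg-cancel 12 (nonNeg-resp-≈
      (solve 4 (λ f g q b → κ 7 :* (κ 5 :* (g :* q) :- κ 12 :* (b :* b)) :+ κ 5 :* g :* (κ 36 :* f :- κ 7 :* q)
                 := κ 12 :* (κ 15 :* (f :* g) :- κ 7 :* (b :* b)))
        ≈-refl φ (φ ^ j) (norm (ι 0ℤ) (ι 1ℤ) (ι s)) (ι (back 0ℤ 1ℤ s j)))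
      (pos 7 · 12back²≤5φ^norm j 0ℤ 1ℤ s 0≤5norm ⊹ pos 5 · φ^n≥0 j · 7norm≤36φ))
      where
      0≤5norm : NonNeg (ι (+ 5) * norm (ι 0ℤ) (ι 1ℤ) (ι s) - ι (+ 12) * (ι 0ℤ * ι 0ℤ))
      0≤5norm = nonNeg-resp-≈
        (solve 1 (λ q → κ 5 :* q := κ 5 :* q :- κ 12 :* (κ 0 :* κ 0)) ≈-refl (norm (ι 0ℤ) (ι 1ℤ) (ι s)))
        (pos 5 · norm≥0 (ι 0ℤ) (ι 1ℤ) (ι s))

    -- Modulo the cubic this norm is 3 φ² - φ + 1, the larger of the two; 43 φ - 21 φ² - 7 ≥ 0
    -- remains, which holds between 11/6 and 37/20.
    7norm[0,1,1]≤36φ : NonNeg (ι (+ 36) * φ - ι (+ 7) * norm (ι 0ℤ) (ι 1ℤ) (ι 1ℤ))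
    7norm[0,1,1]≤36φ = nonNeg-cancel 400 (nonNeg-resp-≈
      (mod-E (ι (+ 2800) * φ)
        (solve 1 (λ f → κ 70 :* (A f :* B f) :+ κ 687 :* B f :+ κ 271
            := κ 400 :* (κ 36 :* f :- κ 7 :* N f (κ 0) (κ 1) (κ 1)) :+ χ f :* (κ 2800 :* f))
          ≈-refl φ))
      (pos 70 · (6φ≥11 · 20φ≤37) ⊹ pos 687 · 20φ≤37 ⊹ pos 271))

    -- Here the norm reduces to φ² + φ + 1, which leaves ample room.
    7norm[0,1,-1]≤36φ : NonNeg (ι (+ 36) * φ - ι (+ 7) * norm (ι 0ℤ) (ι 1ℤ) (ι (ℤ.- 1ℤ)))
    7norm[0,1,-1]≤36φ = nonNeg-cancel 360 (nonNeg-resp-≈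
      (mod-E (- (ι (+ 2520) * φ))
        (solve 1 (λ f → κ 21 :* (A f :* B f) :+ κ 193 :* A f :+ κ 8150
            := κ 360 :* (κ 36 :* f :- κ 7 :* N f (κ 0) (κ 1) (con (ℤ.- 1ℤ))) :+ χ f :* (:- (κ 2520 :* f)))
          ≈-refl φ))
      (pos 21 · (6φ≥11 · 20φ≤37) ⊹ pos 193 · 6φ≥11 ⊹ pos 8150))

    φ^3m≈ : ∀ m → φ ^ (3 ℕ.* m) ≈ φ ^ m * (φ ^ m * φ ^ m)
    φ^3m≈ m = ≈-trans (^-homo-* φ m (m ℕ.+ (m ℕ.+ 0))) (*-congˡ
      (≈-trans (^-homo-* φ m (m ℕ.+ 0)) (*-congˡ (^-congʳ φ (ℕ.+-identityʳ m)))))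

    -- With F = φ^k and g the tribonacci number, the chain is 7 b² · 121 g² ≤ 7 b² · 9 F² ≤ 9 F² ·
    -- 15 F = 135 F³ ≤ 135 · 25 n².
    847[trib*b]²≤3375n² : ∀ t b n → NonNeg (ι (+ 15) * φ ^ (3 ℕ.+ t) - ι (+ 7) * (ι b * ι b)) →
      NonNeg (ι (+ 25) * (ι n * ι n) - φ ^ (3 ℕ.* (3 ℕ.+ t))) → NonNeg (ι (trib (2 ℕ.+ t))) →
      + 847 ℤ.* ((trib (2 ℕ.+ t) ℤ.* b) ℤ.* (trib (2 ℕ.+ t) ℤ.* b)) ℤ.≤ + 3375 ℤ.* (n ℤ.* n)
    847[trib*b]²≤3375n² t b n 7b²≤15F F³≤25n² g≥0 = ℤ.0≤i-j⇒j≤i (nonNeg-ι⁻¹ _ (nonNeg-resp-≈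
      (≈-sym ι-difference)
      (nonNeg-resp-≈
        (solve 4 (λ F g b n →
            κ 135 :* (κ 25 :* (n :* n) :- F :* (F :* F))
              :+ κ 9 :* (F :* F) :* (κ 15 :* F :- κ 7 :* (b :* b))
              :+ κ 7 :* (b :* b) :* ((κ 3 :* F :- κ 11 :* g) :* ((κ 3 :* F :- κ 11 :* g) :+ κ 22 :* g))
            := κ 3375 :* (n :* n) :- κ 847 :* ((g :* b) :* (g :* b)))
          ≈-refl (φ ^ (3 ℕ.+ t)) (ι (trib (2 ℕ.+ t))) (ι b) (ι n))
        (pos 135 · nonNeg-resp-≈ (+-congˡ (-‿cong (φ^3m≈ (3 ℕ.+ t)))) F³≤25n²
          ⊹ pos 9 · nonNeg-x*x _ · 7b²≤15F
          ⊹ pos 7 · nonNeg-x*x _ · (11trib≤3φ^ t · (11trib≤3φ^ t ⊹ pos 22 · g≥0))))))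
      where
      g = trib (2 ℕ.+ t)
      ι-difference : ι (+ 3375 ℤ.* (n ℤ.* n) ℤ.- + 847 ℤ.* ((g ℤ.* b) ℤ.* (g ℤ.* b)))
        ≈ ι (+ 3375) * (ι n * ι n) - ι (+ 847) * ((ι g * ι b) * (ι g * ι b))
      ι-difference = ≈-trans (+-homo (+ 3375 ℤ.* (n ℤ.* n)) (ℤ.- (+ 847 ℤ.* ((g ℤ.* b) ℤ.* (g ℤ.* b)))))
        (+-cong
          (≈-trans (*-homo (+ 3375) (n ℤ.* n)) (*-congˡ (*-homo n n)))
          (≈-trans (-‿homo _) (-‿cong (≈-trans (*-homo (+ 847) ((g ℤ.* b) ℤ.* (g ℤ.* b)))
            (*-congˡ (≈-trans (*-homo (g ℤ.* b) (g ℤ.* b)) (*-cong (*-homo g b) (*-homo g b))))))))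

    -- Since φ ≥ 1, the exponent `suc j` can be raised to the length k, which makes the bound
    -- uniform in `j`.
    7back²≤15φ^k : ∀ {m} c → c ≡ 1ℤ ⊎ c ≡ ℤ.- 1ℤ → ∀ j → suc j ℕ.≤ m →
      NonNeg (ι (+ 15) * φ ^ m - ι (+ 7) * (ι (back 0ℤ 1ℤ c j) * ι (back 0ℤ 1ℤ c j)))
    7back²≤15φ^k {m} c c≡±1 j j<m = nonNeg-resp-≈
      (solve 3 (λ F F′ b → (κ 15 :* F′ :- b) :+ κ 15 :* (F :- F′) := κ 15 :* F :- b)
        ≈-refl (φ ^ m) (φ ^ suc j) (ι (+ 7) * (ι (back 0ℤ 1ℤ c j) * ι (back 0ℤ 1ℤ c j))))
      (7back²≤15φ^ j c (7norm≤36φ c≡±1) ⊹ pos 15 · φ^-mono j<m)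
      where
      7norm≤36φ : c ≡ 1ℤ ⊎ c ≡ ℤ.- 1ℤ → NonNeg (ι (+ 36) * φ - ι (+ 7) * norm (ι 0ℤ) (ι 1ℤ) (ι c))
      7norm≤36φ (inj₁ refl) = 7norm[0,1,1]≤36φ
      7norm≤36φ (inj₂ refl) = 7norm[0,1,-1]≤36φ

    847[trib*back]²≤3375n² : ∀ t n u r → ι (+ 5) * u ≈ r → r ^ 2 ≈ φ ^ (3 ℕ.* (3 ℕ.+ t)) →
      NonNeg r → NonNeg (ι n - u) → 0ℤ ℤ.≤ trib (2 ℕ.+ t) →
      ∀ c → c ≡ 1ℤ ⊎ c ≡ ℤ.- 1ℤ → ∀ j → j ℕ.≤ 2 ℕ.+ t →
      + 847 ℤ.* ((trib (2 ℕ.+ t) ℤ.* back 0ℤ 1ℤ c j) ℤ.* (trib (2 ℕ.+ t) ℤ.* back 0ℤ 1ℤ c j))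
        ℤ.≤ + 3375 ℤ.* (n ℤ.* n)
    847[trib*back]²≤3375n² t n u r 5u≈r r²≈φ^3k 0≤r u≤n 0≤trib c c≡±1 j j≤2+t =
      847[trib*b]²≤3375n² t (back 0ℤ 1ℤ c j) n (7back²≤15φ^k c c≡±1 j (ℕ.s≤s j≤2+t))
        (r²≤25n² (ι n) u r (φ ^ (3 ℕ.* (3 ℕ.+ t))) 5u≈r r²≈φ^3k 0≤r u≤n) (nonNeg-ι 0≤trib)

-- The reals as a commutative ring with a positive cone.

open import Defs

Eventually : (ℕ → Set) → Set
Eventually P = ∃[ N ] (∀ n → N ℕ.≤ n → P n)

eventually-map : ∀ {P Q : ℕ → Set} → (∀ n → P n → Q n) → Eventually P → Eventually Q
eventually-map f (N , p) = N , λ n N≤n → f n (p n N≤n)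

eventually-map₂ : ∀ {P Q R : ℕ → Set} → (∀ n → P n → Q n → R n) →
  Eventually P → Eventually Q → Eventually R
eventually-map₂ f (M , p) (N , q) = M ℕ.⊔ N , λ n M⊔N≤n →
  f n (p n (ℕ.m⊔n≤o⇒m≤o M N M⊔N≤n)) (q n (ℕ.m⊔n≤o⇒n≤o M N M⊔N≤n))

eventually-const : ∀ {P : Set} → Eventually (λ _ → P) → P
eventually-const (N , p) = p N ℕ.≤-refl

0<p*q : ∀ {p q} → 0ℚ ℚ.< p → 0ℚ ℚ.< q → 0ℚ ℚ.< p ℚ.* q
0<p*q {p} {q} 0<p 0<q = ℚ.positive⁻¹ (p ℚ.* q)
  {{ℚ.pos*pos⇒pos p {{ℚ.positive 0<p}} q {{ℚ.positive 0<q}}}}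

0≤p*q : ∀ {p q} → 0ℚ ℚ.≤ p → 0ℚ ℚ.≤ q → 0ℚ ℚ.≤ p ℚ.* q
0≤p*q {p} {q} 0≤p 0≤q = ℚ.nonNegative⁻¹ (p ℚ.* q)
  {{ℚ.nonNeg*nonNeg⇒nonNeg p {{ℚ.nonNegative 0≤p}} q {{ℚ.nonNegative 0≤q}}}}

0≤p*p : ∀ p → 0ℚ ℚ.≤ p ℚ.* p
0≤p*p p with ℚ.≤-total 0ℚ p
... | inj₁ 0≤p = 0≤p*q 0≤p 0≤p
... | inj₂ p≤0 = ℚ.nonNegative⁻¹ (p ℚ.* p)
  {{ℚ.nonPos*nonPos⇒nonPos p {{ℚ.nonPositive p≤0}} p {{ℚ.nonPositive p≤0}}}}

p≤∣p∣ : ∀ p → p ℚ.≤ ∣ p ∣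
p≤∣p∣ p with ℚ.≤-total 0ℚ p
... | inj₁ 0≤p = ℚ.≤-reflexive (sym (ℚ.0≤p⇒∣p∣≡p 0≤p))
... | inj₂ p≤0 = ℚ.≤-trans p≤0 (ℚ.0≤∣p∣ p)

-∣p∣≤p : ∀ p → ℚ.- ∣ p ∣ ℚ.≤ p
-∣p∣≤p p = subst (ℚ.- ∣ p ∣ ℚ.≤_) (solve 1 (λ p → :- :- p := p) refl p)
  (ℚ.neg-antimono-≤ (subst (ℚ.- p ℚ.≤_) (ℚ.∣-p∣≡∣p∣ p) (p≤∣p∣ (ℚ.- p))))
  where open ℚ-Solver

halve : ∀ {ε} → 0ℚ ℚ.< ε → ∃[ δ ] (0ℚ ℚ.< δ × δ ℚ.+ δ ≡ ε)
halve {ε} 0<ε = ε ℚ.* ½ , 0<p*q 0<ε (ℚ.positive⁻¹ ½) ,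
  solve 1 (λ ε → ε :* con ½ :+ ε :* con ½ := ε) refl ε
  where open ℚ-Solver

divide : ∀ C {ε} → 0ℚ ℚ.< C → 0ℚ ℚ.< ε → ∃[ δ ] (0ℚ ℚ.< δ × C ℚ.* δ ≡ ε)
divide C {ε} 0<C 0<ε = ℚ.1/ C ℚ.* ε , 0<p*q (ℚ.positive⁻¹ (ℚ.1/ C) {{ℚ.1/pos⇒pos C}}) 0<ε ,
  trans (sym (ℚ.*-assoc C (ℚ.1/ C) ε))
    (trans (cong (ℚ._* ε) (ℚ.*-inverseʳ C)) (ℚ.*-identityˡ ε))
  where
  instance
    C-pos : ℚ.Positive C
    C-pos = ℚ.positive 0<C
    C-nonZero : ℚ.NonZero C
    C-nonZero = ℚ.pos⇒nonZero C

≃-reflexive : ∀ x y → (∀ n → seq x n ≡ seq y n) → x ≃ y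
≃-reflexive x y x≡y ε 0<ε = 0 , λ n _ → ℚ.≤-trans
  (ℚ.≤-reflexive (cong ∣_∣ (trans (cong (ℚ._- seq y n) (x≡y n)) (ℚ.+-inverseʳ (seq y n)))))
  (ℚ.<⇒≤ 0<ε)

≃-sym : ∀ {x y} → x ≃ y → y ≃ x
≃-sym {x} {y} x≃y ε 0<ε = eventually-map
  (λ n → subst (ℚ._≤ ε) (trans (sym (ℚ.∣-p∣≡∣p∣ (seq x n ℚ.- seq y n)))
    (cong ∣_∣ (solve 2 (λ p q → :- (p :- q) := q :- p) refl (seq x n) (seq y n)))))
  (x≃y ε 0<ε)
  where open ℚ-Solver

private
  ∣p+q∣≤ε : ∀ p q {δ ε} → δ ℚ.+ δ ≡ ε → ∣ p ∣ ℚ.≤ δ → ∣ q ∣ ℚ.≤ δ → ∣ p ℚ.+ q ∣ ℚ.≤ ε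
  ∣p+q∣≤ε p q 2δ≡ε p≤δ q≤δ = ℚ.≤-trans (ℚ.∣p+q∣≤∣p∣+∣q∣ p q)
    (ℚ.≤-trans (ℚ.+-mono-≤ p≤δ q≤δ) (ℚ.≤-reflexive 2δ≡ε))

≃-trans : ∀ {x y z} → x ≃ y → y ≃ z → x ≃ z
≃-trans {x} {y} {z} x≃y y≃z ε 0<ε =
  let δ , 0<δ , 2δ≡ε = halve 0<ε in
  eventually-map₂ (λ n xy yz → subst (ℚ._≤ ε)
      (cong ∣_∣ (solve 3 (λ p q r → (p :- q) :+ (q :- r) := p :- r) refl
        (seq x n) (seq y n) (seq z n)))
      (∣p+q∣≤ε (seq x n ℚ.- seq y n) (seq y n ℚ.- seq z n) 2δ≡ε xy yz))
    (x≃y δ 0<δ) (y≃z δ 0<δ)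
  where open ℚ-Solver

+-cong-≃ : ∀ {x x′ y y′} → x ≃ x′ → y ≃ y′ → x + y ≃ x′ + y′
+-cong-≃ {x} {x′} {y} {y′} x≃x′ y≃y′ ε 0<ε =
  let δ , 0<δ , 2δ≡ε = halve 0<ε in
  eventually-map₂ (λ n xx yy → subst (ℚ._≤ ε)
      (cong ∣_∣ (solve 4 (λ p p′ q q′ → (p :- p′) :+ (q :- q′) := (p :+ q) :- (p′ :+ q′)) refl
        (seq x n) (seq x′ n) (seq y n) (seq y′ n)))
      (∣p+q∣≤ε (seq x n ℚ.- seq x′ n) (seq y n ℚ.- seq y′ n) 2δ≡ε xx yy))
    (x≃x′ δ 0<δ) (y≃y′ δ 0<δ)
  where open ℚ-Solver

eventually-bounded : ∀ x → ∃[ B ] (0ℚ ℚ.< B × Eventually λ n → ∣ seq x n ∣ ℚ.≤ B)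
eventually-bounded x with cauchy x 1ℚ (ℚ.positive⁻¹ 1ℚ)
... | N , close = 1ℚ ℚ.+ ∣ seq x N ∣ ,
  ℚ.+-mono-<-≤ (ℚ.positive⁻¹ 1ℚ) (ℚ.0≤∣p∣ (seq x N)) , N , λ n N≤n →
  subst (λ p → ∣ p ∣ ℚ.≤ 1ℚ ℚ.+ ∣ seq x N ∣)
    (solve 2 (λ p q → (p :- q) :+ q := p) refl (seq x n) (seq x N))
    (ℚ.≤-trans (ℚ.∣p+q∣≤∣p∣+∣q∣ (seq x n ℚ.- seq x N) (seq x N))
      (ℚ.+-monoˡ-≤ ∣ seq x N ∣ (close n N N≤n ℕ.≤-refl)))
  where open ℚ-Solver

*-congˡ-≃ : ∀ x {y y′} → y ≃ y′ → x * y ≃ x * y′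
*-congˡ-≃ x {y} {y′} y≃y′ ε 0<ε =
  let B , 0<B , x≤B = eventually-bounded x
      δ , 0<δ , Bδ≡ε = divide B 0<B 0<ε
  in eventually-map₂ (λ n x≤B yy → begin
    ∣ seq x n ℚ.* seq y n ℚ.- seq x n ℚ.* seq y′ n ∣
      ≡⟨ cong ∣_∣ (solve 3 (λ p q q′ → p :* q :- p :* q′ := p :* (q :- q′)) refl
           (seq x n) (seq y n) (seq y′ n)) ⟩
    ∣ seq x n ℚ.* (seq y n ℚ.- seq y′ n) ∣
      ≡⟨ ℚ.∣p*q∣≡∣p∣*∣q∣ (seq x n) (seq y n ℚ.- seq y′ n) ⟩
    ∣ seq x n ∣ ℚ.* ∣ seq y n ℚ.- seq y′ n ∣
      ≤⟨ ℚ.*-monoˡ-≤-nonNeg ∣ seq x n ∣ {{ℚ.∣-∣-nonNeg (seq x n)}} yy ⟩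
    ∣ seq x n ∣ ℚ.* δ
      ≤⟨ ℚ.*-monoʳ-≤-nonNeg δ {{ℚ.nonNegative (ℚ.<⇒≤ 0<δ)}} x≤B ⟩
    B ℚ.* δ
      ≡⟨ Bδ≡ε ⟩
    ε ∎) x≤B (y≃y′ δ 0<δ)
  where
  open ℚ.≤-Reasoning
  open ℚ-Solver

*-comm-≃ : ∀ x y → x * y ≃ y * x
*-comm-≃ x y = ≃-reflexive (x * y) (y * x) λ n → ℚ.*-comm (seq x n) (seq y n)

*-cong-≃ : ∀ {x x′ y y′} → x ≃ x′ → y ≃ y′ → x * y ≃ x′ * y′
*-cong-≃ {x} {x′} {y} {y′} x≃x′ y≃y′ =
  ≃-trans {x * y} {x * y′} {x′ * y′} (*-congˡ-≃ x {y} {y′} y≃y′)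
    (≃-trans {x * y′} {y′ * x} {x′ * y′} (*-comm-≃ x y′)
      (≃-trans {y′ * x} {y′ * x′} {x′ * y′} (*-congˡ-≃ y′ {x} {x′} x≃x′) (*-comm-≃ y′ x′)))

-- The negation of a Cauchy sequence is obtained as a product, which spares a proof that it is Cauchy.
neg : ℝ → ℝ
neg x = fromℚ (ℚ.- 1ℚ) * x

ℝ-commutativeRing : CommutativeRing 0ℓ 0ℓ
ℝ-commutativeRing = record
  { Carrier = ℝ
  ; _≈_ = _≃_
  ; _+_ = _+_
  ; _*_ = _*_
  ; -_ = neg
  ; 0# = 0ℝ
  ; 1# = 1ℝ
  ; isCommutativeRing = record
    { isRing = record
      { +-isAbelianGroup = record
        { isGroup = record
          { isMonoid = record
            { isSemigroup = record
              { isMagma = record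
                { isEquivalence = record
                  { refl = λ {x} → ≃-reflexive x x λ _ → refl
                  ; sym = λ {x} {y} → ≃-sym {x} {y}
                  ; trans = λ {x} {y} {z} → ≃-trans {x} {y} {z}
                  }
                ; ∙-cong = λ {x} {x′} {y} {y′} → +-cong-≃ {x} {x′} {y} {y′}
                }
              ; assoc = λ x y z → ≃-reflexive (x + y + z) (x + (y + z)) λ n → ℚ.+-assoc (seq x n) (seq y n) (seq z n)
              }
            ; identity = (λ x → ≃-reflexive (0ℝ + x) x λ n → ℚ.+-identityˡ (seq x n))
                       , (λ x → ≃-reflexive (x + 0ℝ) x λ n → ℚ.+-identityʳ (seq x n))
            }
          ; inverse = (λ x → ≃-reflexive (neg x + x) 0ℝ λ n →
                         solve 1 (λ p → con (ℚ.- 1ℚ) :* p :+ p := con 0ℚ) refl (seq x n))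
                    , (λ x → ≃-reflexive (x + neg x) 0ℝ λ n →
                         solve 1 (λ p → p :+ con (ℚ.- 1ℚ) :* p := con 0ℚ) refl (seq x n))
          ; ⁻¹-cong = λ {x} {y} → *-congˡ-≃ (fromℚ (ℚ.- 1ℚ)) {x} {y}
          }
        ; comm = λ x y → ≃-reflexive (x + y) (y + x) λ n → ℚ.+-comm (seq x n) (seq y n)
        }
      ; *-cong = λ {x} {x′} {y} {y′} → *-cong-≃ {x} {x′} {y} {y′}
      ; *-assoc = λ x y z → ≃-reflexive (x * y * z) (x * (y * z)) λ n → ℚ.*-assoc (seq x n) (seq y n) (seq z n)
      ; *-identity = (λ x → ≃-reflexive (1ℝ * x) x λ n → ℚ.*-identityˡ (seq x n))
                   , (λ x → ≃-reflexive (x * 1ℝ) x λ n → ℚ.*-identityʳ (seq x n))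
      ; distrib = (λ x y z → ≃-reflexive (x * (y + z)) (x * y + x * z) λ n → ℚ.*-distribˡ-+ (seq x n) (seq y n) (seq z n))
                , (λ x y z → ≃-reflexive ((y + z) * x) (y * x + z * x) λ n → ℚ.*-distribʳ-+ (seq x n) (seq y n) (seq z n))
      }
    ; *-comm = *-comm-≃
    }
  }
  where open ℚ-Solver

module _ where
  open ℚᵘ using (mkℚᵘ; *≡*; *≤*)

  private
    -- `i / 1` is normalised by a gcd, which blocks computation for a variable `i`; the laws below
    -- are therefore checked on unnormalised fractions with denominator 1.
    toℚᵘ-/1 : ∀ i → ℚ.toℚᵘ (i / 1) ℚᵘ.≃ mkℚᵘ i 0
    toℚᵘ-/1 i = ℚ.toℚᵘ-fromℚᵘ (mkℚᵘ i 0)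

  /1-homo-+ : ∀ i j → (i ℤ.+ j) / 1 ≡ i / 1 ℚ.+ j / 1
  /1-homo-+ i j = ℚ.toℚᵘ-injective (begin
    ℚ.toℚᵘ ((i ℤ.+ j) / 1)                  ≈⟨ toℚᵘ-/1 (i ℤ.+ j) ⟩
    mkℚᵘ (i ℤ.+ j) 0                        ≈⟨ *≡* (cong (ℤ._* + 1) (cong₂ ℤ._+_ (sym (ℤ.*-identityʳ i)) (sym (ℤ.*-identityʳ j)))) ⟩
    mkℚᵘ i 0 ℚᵘ.+ mkℚᵘ j 0                  ≈⟨ ℚᵘₚ.+-cong (toℚᵘ-/1 i) (toℚᵘ-/1 j) ⟨
    ℚ.toℚᵘ (i / 1) ℚᵘ.+ ℚ.toℚᵘ (j / 1)      ≈⟨ ℚ.toℚᵘ-homo-+ (i / 1) (j / 1) ⟨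
    ℚ.toℚᵘ (i / 1 ℚ.+ j / 1)                ∎)
    where open ℚᵘₚ.≃-Reasoning

  /1-homo-* : ∀ i j → (i ℤ.* j) / 1 ≡ (i / 1) ℚ.* (j / 1)
  /1-homo-* i j = ℚ.toℚᵘ-injective (begin
    ℚ.toℚᵘ ((i ℤ.* j) / 1)                  ≈⟨ toℚᵘ-/1 (i ℤ.* j) ⟩
    mkℚᵘ i 0 ℚᵘ.* mkℚᵘ j 0                  ≈⟨ ℚᵘₚ.*-cong (toℚᵘ-/1 i) (toℚᵘ-/1 j) ⟨
    ℚ.toℚᵘ (i / 1) ℚᵘ.* ℚ.toℚᵘ (j / 1)      ≈⟨ ℚ.toℚᵘ-homo-* (i / 1) (j / 1) ⟨
    ℚ.toℚᵘ ((i / 1) ℚ.* (j / 1))                ∎)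
    where open ℚᵘₚ.≃-Reasoning

  /1-mono-≤ : ∀ {i j} → i ℤ.≤ j → i / 1 ℚ.≤ j / 1
  /1-mono-≤ {i} {j} i≤j = ℚ.toℚᵘ-cancel-≤ (begin
    ℚ.toℚᵘ (i / 1)  ≃⟨ toℚᵘ-/1 i ⟩
    mkℚᵘ i 0        ≤⟨ *≤* (ℤ.*-monoʳ-≤-nonNeg 1ℤ i≤j) ⟩
    mkℚᵘ j 0        ≃⟨ toℚᵘ-/1 j ⟨
    ℚ.toℚᵘ (j / 1)  ∎)
    where open ℚᵘₚ.≤-Reasoning

/1-homo‿- : ∀ i → (ℤ.- i) / 1 ≡ ℚ.- 1ℚ ℚ.* (i / 1)
/1-homo‿- i = trans (cong (_/ 1) (sym (ℤ.-1*i≡-i i))) (/1-homo-* (ℤ.- 1ℤ) i)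

-- The tolerance ε makes the predicate respect `≃`; eventual nonnegativity of the terms would not.
NonNeg : ℝ → Set
NonNeg x = ∀ ε → 0ℚ ℚ.< ε → Eventually λ n → ℚ.- ε ℚ.≤ seq x n

nonNeg-resp-≃ : ∀ {x y} → x ≃ y → NonNeg x → NonNeg y
nonNeg-resp-≃ {x} {y} x≃y 0≤x ε 0<ε =
  let δ , 0<δ , 2δ≡ε = halve 0<ε in
  eventually-map₂ (λ n xy x≥-δ → begin
    ℚ.- ε                                     ≡⟨ cong ℚ.-_ 2δ≡ε ⟨
    ℚ.- (δ ℚ.+ δ)                             ≡⟨ ℚ.neg-distrib-+ δ δ ⟩
    ℚ.- δ ℚ.+ ℚ.- δ                           ≤⟨ ℚ.+-mono-≤ x≥-δ (ℚ.neg-antimono-≤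
                                                   (ℚ.≤-trans (p≤∣p∣ (seq x n ℚ.- seq y n)) xy)) ⟩
    seq x n ℚ.+ ℚ.- (seq x n ℚ.- seq y n)     ≡⟨ solve 2 (λ p q → p :+ :- (p :- q) := q) refl (seq x n) (seq y n) ⟩
    seq y n                                   ∎)
    (x≃y δ 0<δ) (0≤x δ 0<δ)
  where
  open ℚ.≤-Reasoning
  open ℚ-Solver

nonNeg-+ : ∀ {x y} → NonNeg x → NonNeg y → NonNeg (x + y)
nonNeg-+ {x} {y} 0≤x 0≤y ε 0<ε =
  let δ , 0<δ , 2δ≡ε = halve 0<ε in
  eventually-map₂ (λ n p q → subst (ℚ._≤ seq x n ℚ.+ seq y n)
      (trans (sym (ℚ.neg-distrib-+ δ δ)) (cong ℚ.-_ 2δ≡ε)) (ℚ.+-mono-≤ p q))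
    (0≤x δ 0<δ) (0≤y δ 0<δ)

private
  -- If p ≥ 0, then p q ≥ - p δ; if p ≤ 0, then p q ≥ (A + B) p ≥ - (A + B) δ. The sum A + B serves
  -- both cases.
  product-≥ : ∀ p q A B δ → 0ℚ ℚ.≤ δ → ℚ.- δ ℚ.≤ p → ℚ.- δ ℚ.≤ q →
    ∣ p ∣ ℚ.≤ A → ∣ q ∣ ℚ.≤ B → ℚ.- ((A ℚ.+ B) ℚ.* δ) ℚ.≤ p ℚ.* q
  product-≥ p q A B δ 0≤δ -δ≤p -δ≤q p≤A q≤B with ℚ.≤-total 0ℚ p
  ... | inj₁ 0≤p = begin
    ℚ.- ((A ℚ.+ B) ℚ.* δ)
      ≤⟨ ℚ.neg-antimono-≤ (ℚ.*-monoʳ-≤-nonNeg δ {{ℚ.nonNegative 0≤δ}} p≤A+B) ⟩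
    ℚ.- (p ℚ.* δ)
      ≡⟨ ℚ.neg-distribʳ-* p δ ⟩
    p ℚ.* ℚ.- δ
      ≤⟨ ℚ.*-monoˡ-≤-nonNeg p {{ℚ.nonNegative 0≤p}} -δ≤q ⟩
    p ℚ.* q ∎
    where
    open ℚ.≤-Reasoning
    p≤A+B : p ℚ.≤ A ℚ.+ B
    p≤A+B = subst (ℚ._≤ A ℚ.+ B) (ℚ.+-identityʳ p)
      (ℚ.+-mono-≤ (ℚ.≤-trans (p≤∣p∣ p) p≤A) (ℚ.≤-trans (ℚ.0≤∣p∣ q) q≤B))
  ... | inj₂ p≤0 = begin
    ℚ.- ((A ℚ.+ B) ℚ.* δ)
      ≡⟨ ℚ.neg-distribʳ-* (A ℚ.+ B) δ ⟩
    (A ℚ.+ B) ℚ.* ℚ.- δ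
      ≤⟨ ℚ.*-monoˡ-≤-nonNeg (A ℚ.+ B) {{ℚ.nonNegative (ℚ.≤-trans (ℚ.0≤∣p∣ q) ∣q∣≤A+B)}} -δ≤p ⟩
    (A ℚ.+ B) ℚ.* p
      ≤⟨ ℚ.*-monoʳ-≤-nonPos p {{ℚ.nonPositive p≤0}} (ℚ.≤-trans (p≤∣p∣ q) ∣q∣≤A+B) ⟩
    q ℚ.* p
      ≡⟨ ℚ.*-comm q p ⟩
    p ℚ.* q ∎
    where
    open ℚ.≤-Reasoning
    ∣q∣≤A+B : ∣ q ∣ ℚ.≤ A ℚ.+ B
    ∣q∣≤A+B = subst (ℚ._≤ A ℚ.+ B) (ℚ.+-identityˡ ∣ q ∣)
      (ℚ.+-mono-≤ (ℚ.≤-trans (ℚ.0≤∣p∣ p) p≤A) q≤B)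

nonNeg-* : ∀ {x y} → NonNeg x → NonNeg y → NonNeg (x * y)
nonNeg-* {x} {y} 0≤x 0≤y ε 0<ε =
  let A , 0<A , x≤A = eventually-bounded x
      B , 0<B , y≤B = eventually-bounded y
      δ , 0<δ , [A+B]δ≡ε = divide (A ℚ.+ B) (ℚ.+-mono-< 0<A 0<B) 0<ε
  in subst (λ ε → Eventually λ n → ℚ.- ε ℚ.≤ seq x n ℚ.* seq y n) [A+B]δ≡ε
       (eventually-map₂
         (λ n (p , p′) (q , q′) → product-≥ (seq x n) (seq y n) A B δ (ℚ.<⇒≤ 0<δ) p q p′ q′)
         (eventually-map₂ (λ _ → _,_) (0≤x δ 0<δ) x≤A)
         (eventually-map₂ (λ _ → _,_) (0≤y δ 0<δ) y≤B))

nonNeg-x*x : ∀ x → NonNeg (x * x)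
nonNeg-x*x x ε 0<ε = 0 , λ n _ →
  ℚ.≤-trans (ℚ.neg-antimono-≤ (ℚ.<⇒≤ 0<ε)) (0≤p*p (seq x n))

<⇒nonNeg : ∀ {x y} → x < y → NonNeg (y + neg x)
<⇒nonNeg {x} {y} (δ , 0<δ , x+δ≤y) ε 0<ε = eventually-map (λ n x+δ≤y → begin
    ℚ.- ε                             ≤⟨ ℚ.neg-antimono-≤ (ℚ.<⇒≤ 0<ε) ⟩
    0ℚ                                ≤⟨ ℚ.<⇒≤ 0<δ ⟩
    δ                                 ≡⟨ solve 2 (λ p δ → δ := p :+ δ :+ con (ℚ.- 1ℚ) :* p) refl (seq x n) δ ⟩
    seq x n ℚ.+ δ ℚ.+ ℚ.- 1ℚ ℚ.* seq x n ≤⟨ ℚ.+-monoˡ-≤ (ℚ.- 1ℚ ℚ.* seq x n) x+δ≤y ⟩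
    seq y n ℚ.+ ℚ.- 1ℚ ℚ.* seq x n    ∎) x+δ≤y
  where
  open ℚ.≤-Reasoning
  open ℚ-Solver

nonNeg-fromℤ : ∀ {z} → 0ℤ ℤ.≤ z → NonNeg (fromℤ z)
nonNeg-fromℤ 0≤z ε 0<ε = 0 , λ n _ →
  ℚ.≤-trans (ℚ.neg-antimono-≤ (ℚ.<⇒≤ 0<ε)) (/1-mono-≤ 0≤z)

-- A negative integer is at most -1, which contradicts the tolerance 1/2.
nonNeg-fromℤ⁻¹ : ∀ z → NonNeg (fromℤ z) → 0ℤ ℤ.≤ z
nonNeg-fromℤ⁻¹ z 0≤z = ℤ.≮⇒≥ λ z<0 → ℚ.≤⇒≤ᵇ {ℚ.- ½} {ℚ.- 1ℚ} (ℚ.≤-trans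
  (eventually-const (0≤z ½ (ℚ.positive⁻¹ ½)))
  (/1-mono-≤ {z} {ℤ.- 1ℤ} (ℤ.i<j⇒i≤pred[j] z<0)))

open CommutativeRing ℝ-commutativeRing using (_-_; semiring)
open Exp semiring using () renaming (_^_ to _^′_)

eventually-nonNeg : ∀ {x} → Eventually (λ n → 0ℚ ℚ.≤ seq x n) → NonNeg x
eventually-nonNeg 0≤x ε 0<ε = eventually-map (λ n → ℚ.≤-trans (ℚ.neg-antimono-≤ (ℚ.<⇒≤ 0<ε))) 0≤x

nonNeg-cancel-ℝ : ∀ n {x} .{{_ : NonZero n}} → NonNeg (fromℤ (+ n) * x) → NonNeg x
nonNeg-cancel-ℝ n {x} 0≤nx = nonNeg-resp-≃ {fromℚ (ℚ.1/ q) * (fromℤ (+ n) * x)} {x}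
  (≃-reflexive (fromℚ (ℚ.1/ q) * (fromℤ (+ n) * x)) x λ i →
    trans (sym (ℚ.*-assoc (ℚ.1/ q) q (seq x i)))
      (trans (cong (ℚ._* seq x i) (ℚ.*-inverseˡ q)) (ℚ.*-identityˡ (seq x i))))
  (nonNeg-* {fromℚ (ℚ.1/ q)} {fromℤ (+ n) * x}
    (eventually-nonNeg {fromℚ (ℚ.1/ q)} (0 , λ _ _ → ℚ.<⇒≤ (ℚ.positive⁻¹ (ℚ.1/ q) {{ℚ.1/pos⇒pos q}})))
    0≤nx)
  where
  q = + n / 1
  instance
    q-pos : ℚ.Positive q
    q-pos = ℚ.normalize-pos n 1
    q-nonZero : ℚ.NonZero q
    q-nonZero = ℚ.pos⇒nonZero q

ℝ-cone : PositiveCone ℝ-commutativeRing 0ℓ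
ℝ-cone = record
  { ℤ⟶R = record
    { ⟦_⟧    = fromℤ
    ; +-homo = λ i j → ≃-reflexive (fromℤ (i ℤ.+ j)) (fromℤ i + fromℤ j) λ _ → /1-homo-+ i j
    ; *-homo = λ i j → ≃-reflexive (fromℤ (i ℤ.* j)) (fromℤ i * fromℤ j) λ _ → /1-homo-* i j
    ; -‿homo = λ i → ≃-reflexive (fromℤ (ℤ.- i)) (neg (fromℤ i)) λ _ → /1-homo‿- i
    ; 0-homo = ≃-reflexive (fromℤ 0ℤ) 0ℝ λ _ → refl
    ; 1-homo = ≃-reflexive (fromℤ 1ℤ) 1ℝ λ _ → refl
    }
  ; NonNeg        = NonNeg
  ; nonNeg-resp-≈ = λ {x} {y} → nonNeg-resp-≃ {x} {y}
  ; nonNeg-+      = λ {x} {y} → nonNeg-+ {x} {y}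
  ; nonNeg-*      = λ {x} {y} → nonNeg-* {x} {y}
  ; nonNeg-x*x    = nonNeg-x*x
  ; nonNeg-ι      = nonNeg-fromℤ
  ; nonNeg-ι⁻¹    = nonNeg-fromℤ⁻¹
  ; nonNeg-cancel = λ n {x} → nonNeg-cancel-ℝ n {x}
  }

-- Enclosing the root φ between 11/6 and 37/20.

-- Written with the trailing factors 1 that `_^_` produces, so that `φ-root` is literally a bound on
-- |χ (seq φ n)|.
χ : ℚ → ℚ
χ x = x ℚ.* (x ℚ.* (x ℚ.* 1ℚ)) ℚ.- (x ℚ.* (x ℚ.* 1ℚ) ℚ.+ x ℚ.+ 1ℚ)

private
  -- The cofactor in χ y - χ x = (y - x) h x y; its quadruple is (2 x + y - 1)² + (3 y² - 2 y - 5).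
  h : ℚ → ℚ → ℚ
  h x y = x ℚ.* x ℚ.+ x ℚ.* y ℚ.+ y ℚ.* y ℚ.- x ℚ.- y ℚ.- 1ℚ

  h-comm : ∀ x y → h x y ≡ h y x
  h-comm = solve 2 (λ x y → x :* x :+ x :* y :+ y :* y :- x :- y :- con 1ℚ
    := y :* y :+ y :* x :+ x :* x :- y :- x :- con 1ℚ) refl
    where open ℚ-Solver

  -- The hypothesis reads (3 q - 5) (q + 1) > 0, a condition on the endpoint alone; the square
  -- absorbs an arbitrary `x`, so the terms of φ need no prior location.
  0<h : ∀ x q → 0ℚ ℚ.< + 3 / 1 ℚ.* (q ℚ.* q) ℚ.- + 2 / 1 ℚ.* q ℚ.- + 5 / 1 → 0ℚ ℚ.< h x q
  0<h x q 0<c = subst (0ℚ ℚ.<_)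
    (solve 2 (λ x q → con (+ 1 / 4) :* ((con (+ 2 / 1) :* x :+ q :- con 1ℚ) :* (con (+ 2 / 1) :* x :+ q :- con 1ℚ)
        :+ (con (+ 3 / 1) :* (q :* q) :- con (+ 2 / 1) :* q :- con (+ 5 / 1)))
      := x :* x :+ x :* q :+ q :* q :- x :- q :- con 1ℚ) refl x q)
    (0<p*q (ℚ.positive⁻¹ (+ 1 / 4)) (ℚ.+-mono-≤-< (0≤p*p (+ 2 / 1 ℚ.* x ℚ.+ q ℚ.- 1ℚ)) 0<c))
    where open ℚ-Solver

  χ-cancel-≤ : ∀ x y → 0ℚ ℚ.< h x y → χ x ℚ.≤ χ y → x ℚ.≤ y
  χ-cancel-≤ x y 0<h χx≤χy = ℚ.*-cancelʳ-≤-pos (h x y) {{ℚ.positive 0<h}} (subst₂ ℚ._≤_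
    (solve 2 (λ x y → χ′ x :+ (x :* h′ x y :- χ′ x) := x :* h′ x y) refl x y)
    (solve 2 (λ x y → χ′ y :+ (x :* h′ x y :- χ′ x) := y :* h′ x y) refl x y)
    (ℚ.+-monoˡ-≤ (x ℚ.* h x y ℚ.- χ x) χx≤χy))
    where
    open ℚ-Solver
    χ′ : ∀ {m} → Polynomial m → Polynomial m
    χ′ x = x :* (x :* (x :* con 1ℚ)) :- (x :* (x :* con 1ℚ) :+ x :+ con 1ℚ)
    h′ : ∀ {m} → Polynomial m → Polynomial m → Polynomial m
    h′ x y = x :* x :+ x :* y :+ y :* y :- x :- y :- con 1ℚ

module Root (φ : ℝ) (φ-root : φ ^ 3 ≃ φ ^ 2 + φ + 1ℝ) where

  -- Eventually |χ| ≤ 1/100 along φ, so an endpoint where χ ≤ -1/100 lies below the terms. The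
  -- tolerance fits both endpoints: χ (11/6) = -7/216 and χ (37/20) = 473/8000.
  eventually-≥ : ∀ q → 0ℚ ℚ.< + 3 / 1 ℚ.* (q ℚ.* q) ℚ.- + 2 / 1 ℚ.* q ℚ.- + 5 / 1 →
    χ q ℚ.≤ ℚ.- (+ 1 / 100) → Eventually λ n → q ℚ.≤ seq φ n
  eventually-≥ q 0<c χq≤-ε = eventually-map
    (λ n ∣χ∣≤ε → χ-cancel-≤ q (seq φ n) (subst (0ℚ ℚ.<_) (h-comm (seq φ n) q) (0<h (seq φ n) q 0<c))
      (ℚ.≤-trans χq≤-ε (ℚ.≤-trans (ℚ.neg-antimono-≤ ∣χ∣≤ε) (-∣p∣≤p (χ (seq φ n))))))
    (φ-root (+ 1 / 100) (ℚ.positive⁻¹ (+ 1 / 100)))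

  eventually-≤ : ∀ q → 0ℚ ℚ.< + 3 / 1 ℚ.* (q ℚ.* q) ℚ.- + 2 / 1 ℚ.* q ℚ.- + 5 / 1 →
    + 1 / 100 ℚ.≤ χ q → Eventually λ n → seq φ n ℚ.≤ q
  eventually-≤ q 0<c ε≤χq = eventually-map
    (λ n ∣χ∣≤ε → χ-cancel-≤ (seq φ n) q (0<h (seq φ n) q 0<c)
      (ℚ.≤-trans (p≤∣p∣ (χ (seq φ n))) (ℚ.≤-trans ∣χ∣≤ε ε≤χq)))
    (φ-root (+ 1 / 100) (ℚ.positive⁻¹ (+ 1 / 100)))

  6φ≥11 : NonNeg (fromℤ (+ 6) * φ - fromℤ (+ 11))
  6φ≥11 = eventually-nonNeg {fromℤ (+ 6) * φ - fromℤ (+ 11)} (eventually-map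
    (λ n 11/6≤φ → ℚ.+-monoˡ-≤ (ℚ.- 1ℚ ℚ.* (+ 11 / 1)) (ℚ.*-monoˡ-≤-nonNeg (+ 6 / 1) 11/6≤φ))
    (eventually-≥ (+ 11 / 6) (ℚ.positive⁻¹ _) (ℚ.≤ᵇ⇒≤ _)))

  20φ≤37 : NonNeg (fromℤ (+ 37) - fromℤ (+ 20) * φ)
  20φ≤37 = eventually-nonNeg {fromℤ (+ 37) - fromℤ (+ 20) * φ} (eventually-map
    (λ n φ≤37/20 → ℚ.+-monoʳ-≤ (+ 37 / 1)
      (ℚ.*-monoˡ-≤-nonPos (ℚ.- 1ℚ) (ℚ.*-monoˡ-≤-nonNeg (+ 20 / 1) φ≤37/20)))
    (eventually-≤ (+ 37 / 20) (ℚ.positive⁻¹ _) (ℚ.≤ᵇ⇒≤ _)))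

-- From the estimates to tribonacci sequences.

-- The power of the definitions and that of the semiring agree by computation for literal exponents
-- such as 3; the exponent 3 k needs this induction.
seq-^ : ∀ x n i → seq (x ^ n) i ≡ seq (x ^′ n) i
seq-^ x zero    i = refl
seq-^ x (suc n) i = cong (seq x i ℚ.*_) (seq-^ x n i)

0<n : ∀ (r : ℝ) n → 0ℝ < r → fromℚ (+ 2 / 10) * r < fromℤ n → 0ℤ ℤ.< n
0<n r n (δ , 0<δ , δ≤r) (ε , 0<ε , r/5+ε≤n) = ℤ.≰⇒> λ n≤0 → ℚ.<-irrefl refl
  (ℚ.<-≤-trans 0<ε (ℚ.≤-trans ε≤n (/1-mono-≤ n≤0)))
  where
  ε≤n : ε ℚ.≤ n / 1
  ε≤n = eventually-const (eventually-map₂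
    (λ i δ≤r r/5+ε≤n → ℚ.≤-trans (subst (ℚ._≤ + 2 / 10 ℚ.* seq r i ℚ.+ ε) (ℚ.+-identityˡ ε)
      (ℚ.+-monoˡ-≤ ε (0≤p*q (ℚ.nonNegative⁻¹ (+ 2 / 10))
        (ℚ.≤-trans (ℚ.<⇒≤ 0<δ) (ℚ.≤-trans (ℚ.≤-reflexive (sym (ℚ.+-identityˡ δ))) δ≤r))))) r/5+ε≤n)
    δ≤r r/5+ε≤n)

-- Reading the first k backward terms in reverse order turns the backward recursion into the
-- tribonacci one and puts `n` last.
tribonacci-from-back : ∀ k .{{_ : NonZero k}} n x y → (∀ j → j ℕ.< k → 0ℤ ℤ.< back n x y j) →
  ∃[ a ] (IsTribonacci {k} a × IsPositive a × TerminatesAt a n)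
tribonacci-from-back k@(suc k′) n x y 0<back = a , recurrence , positive , terminates
  where
  a : Fin k → ℤ
  a i = back n x y (k′ ℕ.∸ toℕ i)

  recurrence : IsTribonacci a
  recurrence h i j l i≡1+h j≡2+h l≡3+h = subst₂
    (λ u v → a l ≡ back n x y u ℤ.+ back n x y v ℤ.+ back n x y (k′ ℕ.∸ toℕ h))
    (sym j′≡) (sym i′≡)
    (subst (λ u → a l ≡ back n x y (1 ℕ.+ m) ℤ.+ back n x y (2 ℕ.+ m) ℤ.+ back n x y u) (sym h′≡)
      (back-recurrence n x y m))
    where
    m = k′ ℕ.∸ toℕ l
    -- The subtraction is truncated; adding `c` on both sides and using that the index `l` is at
    -- most k - 1 makes it exact.
    shift : ∀ {i} c → toℕ l ≡ c ℕ.+ i → k′ ℕ.∸ i ≡ c ℕ.+ m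
    shift {i} c l≡c+i = begin
      k′ ℕ.∸ i                     ≡⟨ ℕ.[m+n]∸[m+o]≡n∸o c k′ i ⟨
      (c ℕ.+ k′) ℕ.∸ (c ℕ.+ i)     ≡⟨ cong ((c ℕ.+ k′) ℕ.∸_) l≡c+i ⟨
      (c ℕ.+ k′) ℕ.∸ toℕ l         ≡⟨ ℕ.+-∸-assoc c (ℕ.≤-pred (Fin.toℕ<n l)) ⟩
      c ℕ.+ m                      ∎
      where open ≡-Reasoning
    j′≡ = shift 1 (trans l≡3+h (cong suc (sym j≡2+h)))
    i′≡ = shift 2 (trans l≡3+h (cong (2 ℕ.+_) (sym i≡1+h)))
    h′≡ = shift 3 l≡3+h

  positive : IsPositive a
  positive i _ = 0<back (k′ ℕ.∸ toℕ i) (ℕ.s≤s (ℕ.m∸n≤m k′ (toℕ i)))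

  terminates : TerminatesAt a n
  terminates = Fin.fromℕ k′ , cong suc (Fin.toℕ-fromℕ k′) ,
    cong (back n x y) (trans (cong (k′ ℕ.∸_) (Fin.toℕ-fromℕ k′)) (ℕ.n∸n≡0 k′))

theorem3 : (φ : ℝ) → φ ^ 3 ≃ φ ^ 2 + φ + 1ℝ →
    (k : ℕ) .{{_ : NonZero k}} →
    (φ^3k/2 : ℝ) → IsRationalPower φ^3k/2 φ (3 ℕ.* k) 2 →
    (n : ℤ) → fromℚ (+ 2 / 10) * φ^3k/2 < fromℤ n →
    ∃[ a ] (IsTribonacci {k} a × IsPositive a × TerminatesAt a n)
-- Lengths 1 and 2 involve no recurrence: n > 0 gives ⟨n⟩ and ⟨1, n⟩, the values 1 being fillers.
theorem3 φ φ-root 1 r (0<r , _) n r/5<n = tribonacci-from-back 1 n 1ℤ 1ℤ λ where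
  zero _ → 0<n r n 0<r r/5<n
  (suc _) (ℕ.s≤s ())
theorem3 φ φ-root 2 r (0<r , _) n r/5<n = tribonacci-from-back 2 n 1ℤ 1ℤ λ where
  zero _ → 0<n r n 0<r r/5<n
  1 _ → ℤ.positive⁻¹ 1ℤ
  (suc (suc _)) (ℕ.s≤s (ℕ.s≤s ()))
-- With k = 3 + t, the tribonacci number of index 2 + t is the last of the k terms 1, 1, 1, 3, ...,
-- s.
theorem3 φ φ-root k@(suc (suc (suc t))) r (0<r , r²≃φ^3k) n r/5<n =
  let x , y , 0<back = 0<back-rounded t n (0<n r n 0<r r/5<n) bound
  in tribonacci-from-back k n x y λ j j<k → 0<back j (ℕ.≤-pred j<k)
  where
  open Root φ φ-root
  open TribonacciBounds ℝ-cone using (847[trib*back]²≤3375n²)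

  5[r/5]≃r : fromℤ (+ 5) * (fromℚ (+ 2 / 10) * r) ≃ r
  5[r/5]≃r = ≃-reflexive (fromℤ (+ 5) * (fromℚ (+ 2 / 10) * r)) r λ i →
    trans (sym (ℚ.*-assoc (+ 5 / 1) (+ 2 / 10) (seq r i))) (ℚ.*-identityˡ (seq r i))

  0≤r : NonNeg r
  0≤r = nonNeg-resp-≃ {r - 0ℝ} {r} (≃-reflexive (r - 0ℝ) r λ i → ℚ.+-identityʳ (seq r i))
    (<⇒nonNeg {0ℝ} {r} 0<r)

  r²≃φ^′3k : r ^ 2 ≃ φ ^′ (3 ℕ.* k)
  r²≃φ^′3k = ≃-trans {r ^ 2} {φ ^ (3 ℕ.* k)} {φ ^′ (3 ℕ.* k)} r²≃φ^3k
    (≃-reflexive (φ ^ (3 ℕ.* k)) (φ ^′ (3 ℕ.* k)) (seq-^ φ (3 ℕ.* k)))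

  bound : ∀ c → c ≡ 1ℤ ⊎ c ≡ ℤ.- 1ℤ → ∀ j → j ℕ.≤ 2 ℕ.+ t →
    + 847 ℤ.* ((trib (2 ℕ.+ t) ℤ.* back 0ℤ 1ℤ c j) ℤ.* (trib (2 ℕ.+ t) ℤ.* back 0ℤ 1ℤ c j))
      ℤ.≤ + 3375 ℤ.* (n ℤ.* n)
  bound = 847[trib*back]²≤3375n² φ φ-root 6φ≥11 20φ≤37 t n (fromℚ (+ 2 / 10) * r) r 5[r/5]≃r
    r²≃φ^′3k 0≤r (<⇒nonNeg {fromℚ (+ 2 / 10) * r} {fromℤ n} r/5<n)
    (ℤ.<⇒≤ (0<trib (2 ℕ.+ t)))
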